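{- Let $f_1,f_2,f_3,f_4\in\mathbb{C}[x,y]$ be pairwise non-proportional binary quadratic forms with $f_1^3+f_2^3=f_3^3+f_4^3$ and $f_1+f_2=T(f_3+f_4)$, where $T\in\mathbb{C}$ with $T(T^3-1)\neq0$, and let $\lambda\in\mathbb{C}$ with $T=\lambda^2$. Then there is an invertible linear change $M$ such that $\{f_1\circ M,f_2\circ M\}=\{F_{3,\lambda},-F_{5,\lambda}\}$ and $\{f_3\circ M,f_4\circ M\}=\{ -F_{4,\lambda},F_{6,\lambda}\}$.
   Context: $\omega=e^{2\pi i/3}$. A linear change is $M(x,y)=(\alpha x+\beta y,\gamma x+\delta y)$ with $\alpha\delta-\beta\gamma\neq0$, and $(f\circ M)(x,y)=f(\alpha x+\beta y,\gamma x+\delta y)$. For $\lambda\in\mathbb{C}$: $F_{3,\lambda}=\lambda^3\omega^2x^2-xy+\lambda^3\omega y^2$, $F_{4,\lambda}=-\lambda\omega^2x^2+\lambda^4xy-\lambda\omega y^2$, $F_{5,\lambda}=\lambda^3\omega x^2-xy+\lambda^3\omega^2y^2$, $F_{6,\lambda}=-\lambda\omega x^2+\lambda^4xy-\lambda\omega^2y^2$. -}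

module Defs where

open import Level using (Level; _⊔_)
open import Algebra.Bundles using (CommutativeRing; Semiring)
open import Data.Nat using (ℕ; suc)
open import Data.List using (List; []; _∷_; map; _∷ʳ_)
open import Data.List.Relation.Binary.Pointwise using (Pointwise)
open import Data.Product using (Σ; ∃; _×_; _,_)
open import Data.Sum using (_⊎_)
open import Relation.Nullary using (¬_)

module Forms {c ℓ : Level} (R : CommutativeRing c ℓ) where
  open CommutativeRing R
  open import Algebra.Definitions.RawSemiring (Semiring.rawSemiring semiring) using (_^_) renaming (_×_ to _·ℕ_)

  pow : Carrier → ℕ → Carrier
  pow = _^_

  K : Set c
  K = Carrier

  evalPoly : List K → K → K
  evalPoly [] t = 0#
  evalPoly (a ∷ p) t = a + t * evalPoly p t

  record IsAlgClosedFieldChar0 : Set (c ⊔ ℓ) where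
    field
      nontrivial : ¬ (1# ≈ 0#)
      inverse    : ∀ x → ¬ (x ≈ 0#) → ∃ λ y → x * y ≈ 1#
      char0      : ∀ (n : ℕ) → ¬ ((suc n ·ℕ 1#) ≈ 0#)
      algClosed  : ∀ (a : K) (cs : List K) → ∃ λ t → evalPoly ((a ∷ cs) ∷ʳ 1#) t ≈ 0#

  -- Binary forms in K[x,y], represented by their coefficient lists
  -- [c₀, c₁, …, c_d] meaning  Σ cᵢ x^(d-i) y^i  (homogeneous of degree d).

  Form : Set c
  Form = List K

  _≈F_ : Form → Form → Set (c ⊔ ℓ)
  _≈F_ = Pointwise _≈_

  addF : Form → Form → Form
  addF [] q = q
  addF p [] = p
  addF (a ∷ p) (b ∷ q) = (a + b) ∷ addF p q

  scaleF : K → Form → Form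
  scaleF k p = map (k *_) p

  negF : Form → Form
  negF p = map -_ p

  mulF : Form → Form → Form
  mulF [] q = []
  mulF (a ∷ p) q = addF (scaleF a q) (0# ∷ mulF p q)

  cubeF : Form → Form
  cubeF f = mulF f (mulF f f)

  quad : K → K → K → Form
  quad a b c' = a ∷ b ∷ c' ∷ []

  -- A linear change M(x,y) = (αx+βy, γx+δy)
  record LinChange : Set c where
    constructor lin
    field α β γ δ : K

  det : LinChange → K
  det (lin α β γ δ) = α * δ - β * γ

  -- (f ∘ M)(x,y) = f(αx+βy, γx+δy) for the quadratic form f = a x² + b xy + c y²
  compQ : K → K → K → LinChange → Form
  compQ a b c' (lin α β γ δ) =
    quad (a * (α * α) + b * (α * γ) + c' * (γ * γ))
         ((1# + 1#) * a * (α * β) + b * (α * δ + β * γ) + (1# + 1#) * c' * (γ * δ))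
         (a * (β * β) + b * (β * δ) + c' * (δ * δ))

  Proportional : (K × K × K) → (K × K × K) → Set (c ⊔ ℓ)
  Proportional (a , b , c') (a' , b' , c'') =
    ∃ λ s → ∃ λ t → ¬ (s ≈ 0# × t ≈ 0#) ×
      (scaleF s (quad a b c') ≈F negF (scaleF t (quad a' b' c'')))

  toF : (K × K × K) → Form
  toF (a , b , c') = quad a b c'

  compT : (K × K × K) → LinChange → Form
  compT (a , b , c') M = compQ a b c' M

  -- The forms F_{3,λ}, …, F_{6,λ} (ω a primitive cube root of unity)
  module Special (ω λ' : K) where
    F3 F4 F5 F6 : Form
    F3 = quad (λ' ^ 3 * (ω ^ 2)) (- 1#) (λ' ^ 3 * ω)
    F4 = quad (- (λ' * (ω ^ 2))) (λ' ^ 4) (- (λ' * ω))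
    F5 = quad (λ' ^ 3 * ω) (- 1#) (λ' ^ 3 * (ω ^ 2))
    F6 = quad (- (λ' * ω)) (λ' ^ 4) (- (λ' * (ω ^ 2)))

  PairEq : Form → Form → Form → Form → Set (c ⊔ ℓ)
  PairEq p q r s = (p ≈F r × q ≈F s) ⊎ (p ≈F s × q ≈F r)

-- Put s = f₃ + f₄, U = (f₃ − f₄) − λ (f₁ − f₂) and V = (f₃ − f₄) + λ (f₁ − f₂). The equation between the
-- cubes becomes s ((T³ − 1) s² − 3 U V) = 0, so U V is a nonzero multiple of s². As f₃ and f₄ are not
-- proportional, U, V and s are not multiples of one form, and hence U = l², V = m², s = l m up to constants
-- for independent linear forms l and m. The change of variables sends l to x − y and m to x + y.
--
-- Constructively, l and m are read off at a point where s ≠ 0. Such a point cannot be chosen by cases, because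
-- equality in R is not decidable. It is instead built from square roots of polynomials in the coefficients;
-- that s ≠ 0 there is a negative statement, for which a doubly negated splitting suffices.

module Submission where

open import Defs
open import Level using (Level; _⊔_)
open import Algebra.Bundles using (CommutativeRing)
open import Data.Product using (∃; _×_; _,_; proj₁; proj₂)
open import Relation.Nullary using (¬_)
import Algebra.Solver.Ring
open import Algebra.Solver.Ring.AlmostCommutativeRing using (fromCommutativeRing; _-Raw-AlmostCommutative⟶_)
open import Data.Integer.Base as ℤ using (ℤ; +_; -[1+_]; _⊖_; +-*-rawRing)
import Data.Integer.Properties as ℤ
open import Data.List.Base using (List; []; _∷_; length)
open import Data.List.Relation.Binary.Pointwise using ([]; _∷_; Pointwise-length)
open import Data.List.Relation.Unary.All as All using (All; []; _∷_)
open import Data.Maybe.Base using (map)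
open import Data.Nat.Base as ℕ using (ℕ; zero; suc)
import Data.Nat.Properties as ℕ
open import Data.Sum using (inj₁)
open import Relation.Binary.PropositionalEquality as ≡ using (_≡_)
open import Relation.Nullary.Decidable using (dec⇒maybe)

-- A ring solver with integer coefficients.

module IntegerSolver {c ℓ} (R : CommutativeRing c ℓ) where
  open CommutativeRing R
  open import Algebra.Properties.Semiring.Mult.TCOptimised semiring
    using (1+×; ×-homo-+; ×1-homo-*) renaming (_×_ to _·_)
  open import Algebra.Properties.Ring ring
    using (-0#≈0#; -‿involutive; -‿distribˡ-*; -‿distribʳ-*; -‿+-comm)
  open import Algebra.Properties.CommutativeSemigroup +-commutativeSemigroup
    using (interchange)
  open import Relation.Binary.Reasoning.Setoid setoid

  -- With the optimised multiple `_·_`, the numeral `con (+ 2)` evaluates to `1# + 1#` itself and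
  -- `con (+ 1)` to `1#`, so solver identities match the goals by computation.
  ⟦_⟧ℤ : ℤ → Carrier
  ⟦ + n ⟧ℤ      = n · 1#
  ⟦ -[1+ n ] ⟧ℤ = - (suc n · 1#)

  ⟦⟧-neg : ∀ i → ⟦ ℤ.- i ⟧ℤ ≈ - ⟦ i ⟧ℤ
  ⟦⟧-neg (+ zero)   = sym -0#≈0#
  ⟦⟧-neg (+ suc n)  = refl
  ⟦⟧-neg (-[1+ n ]) = sym (-‿involutive _)

  ⟦⟧-⊖ : ∀ m n → ⟦ m ⊖ n ⟧ℤ ≈ m · 1# - n · 1#
  ⟦⟧-⊖ m zero = sym (trans (+-congˡ -0#≈0#) (+-identityʳ _))
  ⟦⟧-⊖ zero (suc n) = sym (+-identityˡ _)
  ⟦⟧-⊖ (suc m) (suc n) = begin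
    ⟦ suc m ⊖ suc n ⟧ℤ                  ≡⟨ ≡.cong ⟦_⟧ℤ (ℤ.[1+m]⊖[1+n]≡m⊖n m n) ⟩
    ⟦ m ⊖ n ⟧ℤ                          ≈⟨ ⟦⟧-⊖ m n ⟩
    m · 1# - n · 1#                     ≈⟨ +-identityˡ _ ⟨
    0# + (m · 1# - n · 1#)              ≈⟨ +-congʳ (-‿inverseʳ 1#) ⟨
    (1# - 1#) + (m · 1# - n · 1#)       ≈⟨ interchange _ _ _ _ ⟩
    (1# + m · 1#) + (- 1# - n · 1#)     ≈⟨ +-congˡ (-‿+-comm _ _) ⟩
    (1# + m · 1#) - (1# + n · 1#)       ≈⟨ +-cong (1+× m 1#) (-‿cong (1+× n 1#)) ⟨
    suc m · 1# - suc n · 1#             ∎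

  ⟦⟧-+ : ∀ i j → ⟦ i ℤ.+ j ⟧ℤ ≈ ⟦ i ⟧ℤ + ⟦ j ⟧ℤ
  ⟦⟧-+ (+ m) (+ n)           = ×-homo-+ 1# m n
  ⟦⟧-+ (+ m) (-[1+ n ])      = ⟦⟧-⊖ m (suc n)
  ⟦⟧-+ (-[1+ m ]) (+ n)      = trans (⟦⟧-⊖ n (suc m)) (+-comm _ _)
  ⟦⟧-+ (-[1+ m ]) (-[1+ n ]) = begin
    - (suc (suc (m ℕ.+ n)) · 1#)        ≡⟨ ≡.cong (λ k → - (suc k · 1#)) (≡.sym (ℕ.+-suc m n)) ⟩
    - ((suc m ℕ.+ suc n) · 1#)          ≈⟨ -‿cong (×-homo-+ 1# (suc m) (suc n)) ⟩
    - (suc m · 1# + suc n · 1#)         ≈⟨ -‿+-comm _ _ ⟨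
    - (suc m · 1#) - suc n · 1#         ∎

  ⟦⟧-*ⁿ : ∀ m j → ⟦ + m ℤ.* j ⟧ℤ ≈ (m · 1#) * ⟦ j ⟧ℤ
  ⟦⟧-*ⁿ m (+ n) = trans (reflexive (≡.cong ⟦_⟧ℤ (ℤ.+◃n≡+n (m ℕ.* n)))) (×1-homo-* m n)
  ⟦⟧-*ⁿ m (-[1+ n ]) = begin
    ⟦ + m ℤ.* -[1+ n ] ⟧ℤ               ≡⟨ ≡.cong ⟦_⟧ℤ (ℤ.neg-distribʳ-* (+ m) (+ suc n)) ⟨
    ⟦ ℤ.- (+ m ℤ.* + suc n) ⟧ℤ          ≈⟨ ⟦⟧-neg (+ m ℤ.* + suc n) ⟩
    - ⟦ + m ℤ.* + suc n ⟧ℤ              ≈⟨ -‿cong (⟦⟧-*ⁿ m (+ suc n)) ⟩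
    - (m · 1# * (suc n · 1#))           ≈⟨ -‿distribʳ-* _ _ ⟩
    m · 1# * - (suc n · 1#)             ∎

  ⟦⟧-* : ∀ i j → ⟦ i ℤ.* j ⟧ℤ ≈ ⟦ i ⟧ℤ * ⟦ j ⟧ℤ
  ⟦⟧-* (+ m)      j = ⟦⟧-*ⁿ m j
  ⟦⟧-* (-[1+ m ]) j = begin
    ⟦ -[1+ m ] ℤ.* j ⟧ℤ                 ≡⟨ ≡.cong ⟦_⟧ℤ (ℤ.neg-distribˡ-* (+ suc m) j) ⟨
    ⟦ ℤ.- (+ suc m ℤ.* j) ⟧ℤ            ≈⟨ ⟦⟧-neg (+ suc m ℤ.* j) ⟩
    - ⟦ + suc m ℤ.* j ⟧ℤ                ≈⟨ -‿cong (⟦⟧-*ⁿ (suc m) j) ⟩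
    - (suc m · 1# * ⟦ j ⟧ℤ)             ≈⟨ -‿distribˡ-* _ _ ⟩
    - (suc m · 1#) * ⟦ j ⟧ℤ             ∎

  ℤ⟶R : +-*-rawRing -Raw-AlmostCommutative⟶ fromCommutativeRing R
  ℤ⟶R = record
    { ⟦_⟧    = ⟦_⟧ℤ
    ; +-homo = ⟦⟧-+
    ; *-homo = ⟦⟧-*
    ; -‿homo = ⟦⟧-neg
    ; 0-homo = refl
    ; 1-homo = refl
    }

  open Algebra.Solver.Ring +-*-rawRing (fromCommutativeRing R) ℤ⟶R
    (λ i j → map (λ eq → reflexive (≡.cong ⟦_⟧ℤ eq)) (dec⇒maybe (i ℤ.≟ j))) public

-- Algebra in a field without decidable equality.

module AlgClosedField {c ℓ} (R : CommutativeRing c ℓ) (isAlgClosed : Forms.IsAlgClosedFieldChar0 R) where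
  open CommutativeRing R
  open Forms R
  open IsAlgClosedFieldChar0 isAlgClosed
  open IntegerSolver R
  open import Algebra.Properties.Semiring.Mult.TCOptimised semiring
    using (×ᵤ≈×; ×-homo-+) renaming (_×_ to _·_)
  open import Algebra.Properties.Group +-group using (x∙y⁻¹≈ε⇒x≈y; x≈y⇒x∙y⁻¹≈ε)
  open import Relation.Binary.Reasoning.Setoid setoid

  infixl 6 _⊕_
  infix  7 _⊙_

  -- Together with `_⊙_` this checks certificates: the solver writes a quantity as a combination of
  -- terms known to vanish, and the combinators follow the shape of that combination.
  _⊕_ : ∀ {x y} → x ≈ 0# → y ≈ 0# → x + y ≈ 0#
  x≈0 ⊕ y≈0 = trans (+-cong x≈0 y≈0) (+-identityˡ 0#)

  _⊙_ : ∀ x {y} → y ≈ 0# → x * y ≈ 0#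
  x ⊙ y≈0 = trans (*-congˡ y≈0) (zeroʳ x)

  difference : ∀ {x y} → x ≈ y → x - y ≈ 0#
  difference = x≈y⇒x∙y⁻¹≈ε

  undifference : ∀ {x y} → x - y ≈ 0# → x ≈ y
  undifference = x∙y⁻¹≈ε⇒x≈y _ _

  *-cancel : ∀ {a x} → ¬ (a ≈ 0#) → a * x ≈ 0# → x ≈ 0#
  *-cancel {a} {x} a≉0 ax≈0 =
    let a⁻¹ , aa⁻¹≈1 = inverse a a≉0 in
    trans (solve 3 (λ a b x → x := b :* (a :* x) :+ (:- x) :* (a :* b :- con (+ 1))) refl a a⁻¹ x)
          (a⁻¹ ⊙ ax≈0 ⊕ (- x) ⊙ difference aa⁻¹≈1)

  *-≉0 : ∀ {x y} → ¬ (x ≈ 0#) → ¬ (y ≈ 0#) → ¬ (x * y ≈ 0#)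
  *-≉0 x≉0 y≉0 xy≈0 = y≉0 (*-cancel x≉0 xy≈0)

  *-≉0ˡ : ∀ {x y} → ¬ (x * y ≈ 0#) → ¬ (x ≈ 0#)
  *-≉0ˡ xy≉0 x≈0 = xy≉0 (trans (*-congʳ x≈0) (zeroˡ _))

  *-≉0ʳ : ∀ {x y} → ¬ (x * y ≈ 0#) → ¬ (y ≈ 0#)
  *-≉0ʳ xy≉0 y≈0 = xy≉0 (trans (*-congˡ y≈0) (zeroʳ _))

  n·1≉0 : ∀ n → ¬ (suc n · 1# ≈ 0#)
  n·1≉0 n n≈0 = char0 n (trans (×ᵤ≈× (suc n) 1#) n≈0)

  squareRoot : ∀ a → ∃ λ r → r * r ≈ a
  squareRoot a =
    let r , root = algClosed (- a) (0# ∷ []) in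
    r , undifference (trans
      (solve 2 (λ a r → r :* r :- a := :- a :+ r :* (con (+ 0) :+ r :* (con (+ 1) :+ r :* con (+ 0)))) refl a r)
      root)

  -- Polynomials in one variable: from vanishing values to vanishing coefficients.

  AllZero : List K → Set _
  AllZero = All (_≈ 0#)

  evalPoly-zero : ∀ {p} → AllZero p → ∀ t → evalPoly p t ≈ 0#
  evalPoly-zero []         t = refl
  evalPoly-zero (a≈0 ∷ zs) t = a≈0 ⊕ t ⊙ evalPoly-zero zs t

  evalPoly-addF : ∀ p q t → evalPoly (addF p q) t ≈ evalPoly p t + evalPoly q t
  evalPoly-addF []      q       t = sym (+-identityˡ _)
  evalPoly-addF (a ∷ p) []      t = sym (+-identityʳ _)
  evalPoly-addF (a ∷ p) (b ∷ q) t = trans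
    (+-congˡ (*-congˡ (evalPoly-addF p q t)))
    (solve 5 (λ a b t x y → a :+ b :+ t :* (x :+ y) := a :+ t :* x :+ (b :+ t :* y)) refl a b t _ _)

  evalPoly-scaleF : ∀ k p t → evalPoly (scaleF k p) t ≈ k * evalPoly p t
  evalPoly-scaleF k []      t = sym (zeroʳ k)
  evalPoly-scaleF k (a ∷ p) t = trans
    (+-congˡ (*-congˡ (evalPoly-scaleF k p t)))
    (solve 4 (λ k a t x → k :* a :+ t :* (k :* x) := k :* (a :+ t :* x)) refl k a t _)

  evalPoly-mulF : ∀ p q t → evalPoly (mulF p q) t ≈ evalPoly p t * evalPoly q t
  evalPoly-mulF []      q t = sym (zeroˡ _)
  evalPoly-mulF (a ∷ p) q t = begin
    evalPoly (addF (scaleF a q) (0# ∷ mulF p q)) t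
      ≈⟨ evalPoly-addF (scaleF a q) (0# ∷ mulF p q) t ⟩
    evalPoly (scaleF a q) t + (0# + t * evalPoly (mulF p q) t)
      ≈⟨ +-cong (evalPoly-scaleF a q t) (+-congˡ (*-congˡ (evalPoly-mulF p q t))) ⟩
    a * evalPoly q t + (0# + t * (evalPoly p t * evalPoly q t))
      ≈⟨ solve 4 (λ a t x y → a :* y :+ (con (+ 0) :+ t :* (x :* y)) := (a :+ t :* x) :* y) refl a t _ _ ⟩
    evalPoly (a ∷ p) t * evalPoly q t ∎

  -- The quotient of a ∷ p by t − m; it does not depend on a.
  quotient : K → List K → List K
  quotient m []      = []
  quotient m (b ∷ p) = evalPoly (b ∷ p) m ∷ quotient m p

  length-quotient : ∀ m p → length (quotient m p) ≡ length p
  length-quotient m []      = ≡.refl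
  length-quotient m (b ∷ p) = ≡.cong suc (length-quotient m p)

  evalPoly-quotient : ∀ m a p t → evalPoly (a ∷ p) t ≈ evalPoly (a ∷ p) m + (t - m) * evalPoly (quotient m p) t
  evalPoly-quotient m a []      t =
    solve 3 (λ m a t → a :+ t :* con (+ 0) := a :+ m :* con (+ 0) :+ (t :- m) :* con (+ 0)) refl m a t
  evalPoly-quotient m a (b ∷ p) t = trans
    (+-congˡ (*-congˡ (evalPoly-quotient m b p t)))
    (solve 5 (λ m a t e q → a :+ t :* (e :+ (t :- m) :* q) := a :+ m :* e :+ (t :- m) :* (e :+ t :* q))
      refl m a t _ _)

  -- Horner's scheme run backwards: each coefficient is a value at m minus m times the next
  -- coefficient of the quotient.
  quotient-zero : ∀ m a p → evalPoly (a ∷ p) m ≈ 0# → AllZero (quotient m p) → AllZero (a ∷ p)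
  quotient-zero m a []      root []         =
    trans (solve 2 (λ m a → a := a :+ m :* con (+ 0)) refl m a) root ∷ []
  quotient-zero m a (b ∷ p) root (e≈0 ∷ zs) =
    trans (solve 3 (λ m a e → a := a :+ m :* e :+ (:- m) :* e) refl m a _) (root ⊕ (- m) ⊙ e≈0)
    ∷ quotient-zero m b p e≈0 zs

  -- Division by t - m lowers the length and leaves a quotient that vanishes from m + 1 onwards.
  -- Asking for zeros at all later naturals avoids counting roots; `n` bounds the recursion, since
  -- the quotient is not a sublist of `p`.
  zero-at-naturals : ∀ n p → length p ≡ n → ∀ m → (∀ k → evalPoly p ((k ℕ.+ m) · 1#) ≈ 0#) → AllZero p
  zero-at-naturals _       []      _  m zeros = []
  zero-at-naturals (suc n) (a ∷ p) eq m zeros =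
    quotient-zero M a p (zeros 0) (zero-at-naturals n (quotient M p)
      (≡.trans (length-quotient M p) (ℕ.suc-injective eq)) (suc m) quotient-zeros)
    where
    M = m · 1#
    quotient-zeros : ∀ k → evalPoly (quotient M p) ((k ℕ.+ suc m) · 1#) ≈ 0#
    -- The point and m differ by `suc k · 1#`, which characteristic 0 makes cancellable.
    quotient-zeros k rewrite ℕ.+-suc k m = *-cancel {suc k · 1#} (n·1≉0 k) (begin
      suc k · 1# * q
        ≈⟨ solve 3 (λ s m q → s :* q := (s :+ m :- m) :* q) refl (suc k · 1#) M q ⟩
      (suc k · 1# + M - M) * q
        ≈⟨ *-congʳ (+-congʳ (×-homo-+ 1# (suc k) m)) ⟨
      (T - M) * q
        ≈⟨ solve 2 (λ x y → y := x :+ y :- x) refl (evalPoly (a ∷ p) M) ((T - M) * q) ⟩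
      evalPoly (a ∷ p) M + (T - M) * q - evalPoly (a ∷ p) M
        ≈⟨ +-congʳ (evalPoly-quotient M a p T) ⟨
      evalPoly (a ∷ p) T - evalPoly (a ∷ p) M
        ≈⟨ difference (trans (zeros (suc k)) (sym (zeros 0))) ⟩
      0# ∎)
      where
      T = suc (k ℕ.+ m) · 1#
      q = evalPoly (quotient M p) T

  -- The lowest coefficient of q is killed by p (0) ≠ 0; what remains is t times the same problem
  -- for the tail. Only p (0) has to be known nonzero, so no test on other coefficients of p occurs.
  evalPoly-cancel : ∀ p q → ¬ (evalPoly p 0# ≈ 0#) → (∀ t → evalPoly p t * evalPoly q t ≈ 0#) → AllZero q
  evalPoly-cancel p []      p₀≉0 pq≈0 = []
  evalPoly-cancel p (a ∷ q) p₀≉0 pq≈0 = a≈0 ∷ evalPoly-cancel p q p₀≉0 pq′≈0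
    where
    a≈0 : a ≈ 0#
    a≈0 = *-cancel p₀≉0 (trans
      (solve 3 (λ x a y → x :* a := x :* (a :+ con (+ 0) :* y)) refl (evalPoly p 0#) a (evalPoly q 0#))
      (pq≈0 0#))
    t·pq′≈0 : ∀ t → evalPoly (0# ∷ mulF p q) t ≈ 0#
    t·pq′≈0 t = trans (+-congˡ (*-congˡ (evalPoly-mulF p q t))) (trans
      (solve 4 (λ t x a y → con (+ 0) :+ t :* (x :* y) := x :* (a :+ t :* y) :+ (:- x) :* a)
        refl t (evalPoly p t) a (evalPoly q t))
      (pq≈0 t ⊕ (- evalPoly p t) ⊙ a≈0))
    pq′≈0 : ∀ t → evalPoly p t * evalPoly q t ≈ 0#
    -- The factor t is removed by dropping the first coefficient; cancelling it pointwise would say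
    -- nothing at t = 0.
    pq′≈0 t = trans (sym (evalPoly-mulF p q t)) (evalPoly-zero
      (All.tail (zero-at-naturals _ (0# ∷ mulF p q) ≡.refl 0 (λ k → t·pq′≈0 ((k ℕ.+ 0) · 1#)))) t)

-- Binary quadratic forms as triples, and the relation A B = C² for diagonal A.

module Quadratics {c ℓ} (R : CommutativeRing c ℓ) (isAlgClosed : Forms.IsAlgClosedFieldChar0 R) where
  open CommutativeRing R
  open Forms R
  open IntegerSolver R
  open AlgClosedField R isAlgClosed

  Quad : Set c
  Quad = K × K × K

  ev : Quad → K → K → K
  ev (a , b , d) x y = a * (x * x) + b * (x * y) + d * (y * y)

  evᴾ : ∀ {n} → (a b d x y : Polynomial n) → Polynomial n
  evᴾ a b d x y = a :* (x :* x) :+ b :* (x :* y) :+ d :* (y :* y)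

  _≈Q_ : Quad → Quad → Set ℓ
  (a , b , d) ≈Q (a′ , b′ , d′) = (a ≈ a′) × (b ≈ b′) × (d ≈ d′)

  ev-cong : ∀ {f g} → f ≈Q g → ∀ x y → ev f x y ≈ ev g x y
  ev-cong (p , q , r) x y = +-cong (+-cong (*-congʳ p) (*-congʳ q)) (*-congʳ r)

  ev-arg-cong : ∀ f {x x′ y y′} → x ≈ x′ → y ≈ y′ → ev f x y ≈ ev f x′ y′
  ev-arg-cong f p q =
    +-cong (+-cong (*-congˡ (*-cong p p)) (*-congˡ (*-cong p q))) (*-congˡ (*-cong q q))

  ev-injective : ∀ f g → (∀ x y → ev f x y ≈ ev g x y) → f ≈Q g
  ev-injective f@(a , b , d) g@(a′ , b′ , d′) f≈g = a≈a′ , undifference b-b′≈0 , d≈d′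
    where
    at-1-0 : ∀ a b d → ev (a , b , d) 1# 0# ≈ a
    at-1-0 = solve 3 (λ a b d → evᴾ a b d (con (+ 1)) (con (+ 0)) := a) refl
    at-0-1 : ∀ a b d → ev (a , b , d) 0# 1# ≈ d
    at-0-1 = solve 3 (λ a b d → evᴾ a b d (con (+ 0)) (con (+ 1)) := d) refl
    a≈a′ : a ≈ a′
    a≈a′ = trans (sym (at-1-0 a b d)) (trans (f≈g 1# 0#) (at-1-0 a′ b′ d′))
    d≈d′ : d ≈ d′
    d≈d′ = trans (sym (at-0-1 a b d)) (trans (f≈g 0# 1#) (at-0-1 a′ b′ d′))
    b-b′≈0 : b - b′ ≈ 0#
    b-b′≈0 = trans
      (solve 6 (λ a b d a′ b′ d′ → b :- b′ :=
          evᴾ a b d (con (+ 1)) (con (+ 1)) :- evᴾ a′ b′ d′ (con (+ 1)) (con (+ 1))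
          :+ con -[1+ 0 ] :* (a :- a′) :+ con -[1+ 0 ] :* (d :- d′))
        refl a b d a′ b′ d′)
      (difference (f≈g 1# 1#) ⊕ (- 1#) ⊙ difference a≈a′ ⊕ (- 1#) ⊙ difference d≈d′)

  toF-cong : ∀ {f g} → f ≈Q g → toF f ≈F toF g
  toF-cong (p , q , r) = p ∷ q ∷ r ∷ []

  addQ : Quad → Quad → Quad
  addQ (a , b , d) (a′ , b′ , d′) = a + a′ , b + b′ , d + d′

  scaleQ : K → Quad → Quad
  scaleQ k (a , b , d) = k * a , k * b , k * d

  ev-addQ : ∀ f g x y → ev (addQ f g) x y ≈ ev f x y + ev g x y
  ev-addQ (a , b , d) (a′ , b′ , d′) x y =
    solve 8 (λ a b d a′ b′ d′ x y → evᴾ (a :+ a′) (b :+ b′) (d :+ d′) x y := evᴾ a b d x y :+ evᴾ a′ b′ d′ x y)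
      refl a b d a′ b′ d′ x y

  ev-scaleQ : ∀ k f x y → ev (scaleQ k f) x y ≈ k * ev f x y
  ev-scaleQ k (a , b , d) x y =
    solve 6 (λ k a b d x y → evᴾ (k :* a) (k :* b) (k :* d) x y := k :* evᴾ a b d x y) refl k a b d x y

  -- The coefficients of `compQ` kept as a triple: `toF` of it is `compT` by computation, and
  -- `ev-injective` applies.
  compose : Quad → LinChange → Quad
  compose (a , b , d) (lin α β γ δ) =
    a * (α * α) + b * (α * γ) + d * (γ * γ) ,
    (1# + 1#) * a * (α * β) + b * (α * δ + β * γ) + (1# + 1#) * d * (γ * δ) ,
    a * (β * β) + b * (β * δ) + d * (δ * δ)

  ev-compose : ∀ f α β γ δ x y → ev (compose f (lin α β γ δ)) x y ≈ ev f (α * x + β * y) (γ * x + δ * y)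
  ev-compose (a , b , d) α β γ δ x y =
    solve 9 (λ a b d α β γ δ x y →
      evᴾ (evᴾ a b d α γ)
          ((con (+ 2)) :* a :* (α :* β) :+ b :* (α :* δ :+ β :* γ) :+ (con (+ 2)) :* d :* (γ :* δ))
          (evᴾ a b d β δ) x y
      := evᴾ a b d (α :* x :+ β :* y) (γ :* x :+ δ :* y)) refl a b d α β γ δ x y

  -- Comparing coefficients in A B = C² gives c₁ ζ = 0 and e c₁² = ζ² for ζ = c₂ − e c₀, and c₁ = 0 would make
  -- both B and C multiples of A.
  module Diagonal (e b₀ b₁ b₂ c₀ c₁ c₂ : K)
    (CE≈0 : ∀ x y → ev (c₀ , c₁ , c₂) x y *
      (ev (1# , 0# , e) x y * ev (b₀ , b₁ , b₂) x y - ev (c₀ , c₁ , c₂) x y * ev (c₀ , c₁ , c₂) x y) ≈ 0#)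
    (not-collinear : ¬ (∃ λ k →
      ((c₀ , c₁ , c₂) ≈Q scaleQ k (1# , 0# , e)) × ((b₀ , b₁ , b₂) ≈Q scaleQ (k * k) (1# , 0# , e))))
    (c₀≉0 : ¬ (c₀ ≈ 0#))
    where

    ζ : K
    ζ = c₂ - e * c₀

    -- The coefficients in t of C and of A B - C² at (1, t), where A = x² + e y².
    Cₜ Eₜ : List K
    Cₜ = c₀ ∷ c₁ ∷ c₂ ∷ []
    Eₜ = b₀ - c₀ * c₀
       ∷ b₁ - (1# + 1#) * (c₀ * c₁)
       ∷ b₂ + e * b₀ - (c₁ * c₁ + (1# + 1#) * (c₀ * c₂))
       ∷ e * b₁ - (1# + 1#) * (c₁ * c₂)
       ∷ e * b₂ - c₂ * c₂
       ∷ []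

    Eₜ-zero : AllZero Eₜ
    Eₜ-zero = evalPoly-cancel Cₜ Eₜ constant≉0 λ t → trans
      (solve 8 (λ t e b₀ b₁ b₂ c₀ c₁ c₂ →
          let o = con (+ 0)
              i = con (+ 1)
              C = evᴾ c₀ c₁ c₂ i t in
          (c₀ :+ t :* (c₁ :+ t :* (c₂ :+ t :* o))) :*
          (b₀ :- c₀ :* c₀ :+ t :* (b₁ :- con (+ 2) :* (c₀ :* c₁) :+ t :*
            (b₂ :+ e :* b₀ :- (c₁ :* c₁ :+ con (+ 2) :* (c₀ :* c₂)) :+ t :*
            (e :* b₁ :- con (+ 2) :* (c₁ :* c₂) :+ t :* (e :* b₂ :- c₂ :* c₂ :+ t :* o)))))
          := C :* (evᴾ i o e i t :* evᴾ b₀ b₁ b₂ i t :- C :* C))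
        refl t e b₀ b₁ b₂ c₀ c₁ c₂)
      (CE≈0 1# t)
      where
      constant≉0 : ¬ (evalPoly Cₜ 0# ≈ 0#)
      constant≉0 constant≈0 = c₀≉0 (trans
        (solve 2 (λ c₀ r → c₀ := c₀ :+ con (+ 0) :* r) refl c₀ (c₁ + 0# * (c₂ + 0# * 0#))) constant≈0)

    b₀≈c₀² : b₀ - c₀ * c₀ ≈ 0#
    b₀≈c₀² = All.head Eₜ-zero

    b₁≈2c₀c₁ : b₁ - (1# + 1#) * (c₀ * c₁) ≈ 0#
    b₁≈2c₀c₁ = All.head (All.tail Eₜ-zero)

    b₂+eb₀≈c₁²+2c₀c₂ : b₂ + e * b₀ - (c₁ * c₁ + (1# + 1#) * (c₀ * c₂)) ≈ 0#
    b₂+eb₀≈c₁²+2c₀c₂ = All.head (All.tail (All.tail Eₜ-zero))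

    eb₁≈2c₁c₂ : e * b₁ - (1# + 1#) * (c₁ * c₂) ≈ 0#
    eb₁≈2c₁c₂ = All.head (All.tail (All.tail (All.tail Eₜ-zero)))

    eb₂≈c₂² : e * b₂ - c₂ * c₂ ≈ 0#
    eb₂≈c₂² = All.head (All.tail (All.tail (All.tail (All.tail Eₜ-zero))))

    -- The coefficients of t and t³ give two values of e b₁, which differ by 2 c₁ ζ.
    c₁ζ≈0 : c₁ * ζ ≈ 0#
    c₁ζ≈0 = *-cancel {1# + 1#} (n·1≉0 1) (trans
      (solve 5 (λ e b₁ c₀ c₁ c₂ →
          con (+ 2) :* (c₁ :* (c₂ :- e :* c₀)) :=
          e :* (b₁ :- con (+ 2) :* (c₀ :* c₁)) :+ con -[1+ 0 ] :* (e :* b₁ :- con (+ 2) :* (c₁ :* c₂)))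
        refl e b₁ c₀ c₁ c₂)
      (e ⊙ b₁≈2c₀c₁ ⊕ (- 1#) ⊙ eb₁≈2c₁c₂))

    -- Elimination of b₀ and b₂ between the coefficients of 1, t² and t⁴.
    c₁²e≈ζ² : c₁ * c₁ * e - ζ * ζ ≈ 0#
    c₁²e≈ζ² = trans
      (solve 6 (λ e b₀ b₂ c₀ c₁ c₂ →
          c₁ :* c₁ :* e :- (c₂ :- e :* c₀) :* (c₂ :- e :* c₀) :=
          con (+ 1) :* (e :* b₂ :- c₂ :* c₂)
          :+ (:- e) :* (b₂ :+ e :* b₀ :- (c₁ :* c₁ :+ con (+ 2) :* (c₀ :* c₂)))
          :+ (e :* e) :* (b₀ :- c₀ :* c₀))
        refl e b₀ b₂ c₀ c₁ c₂)
      (1# ⊙ eb₂≈c₂² ⊕ (- e) ⊙ b₂+eb₀≈c₁²+2c₀c₂ ⊕ (e * e) ⊙ b₀≈c₀²)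

    c₁≉0 : ¬ (c₁ ≈ 0#)
    c₁≉0 c₁≈0 = *-≉0 ζ≉0 ζ≉0 (trans
      (solve 3 (λ c e ζ → ζ :* ζ := (c :* e) :* c :+ con -[1+ 0 ] :* (c :* c :* e :- ζ :* ζ)) refl c₁ e ζ)
      ((c₁ * e) ⊙ c₁≈0 ⊕ (- 1#) ⊙ c₁²e≈ζ²))
      where
      ζ≉0 : ¬ (ζ ≈ 0#)
      -- For c₁ = ζ = 0 the coefficients say C = c₀ A and B = c₀² A.
      ζ≉0 ζ≈0 = not-collinear (c₀ ,
        (sym (*-identityʳ c₀) ,
         trans c₁≈0 (sym (zeroʳ c₀)) ,
         trans (undifference ζ≈0) (*-comm e c₀)) ,
        (trans (undifference b₀≈c₀²) (sym (*-identityʳ _)) ,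
         undifference (trans
           (solve 3 (λ b₁ c₀ c₁ → b₁ :- c₀ :* c₀ :* con (+ 0) :=
               con (+ 1) :* (b₁ :- con (+ 2) :* (c₀ :* c₁)) :+ con (+ 2) :* c₀ :* c₁)
             refl b₁ c₀ c₁)
           (1# ⊙ b₁≈2c₀c₁ ⊕ ((1# + 1#) * c₀) ⊙ c₁≈0)) ,
         undifference (trans
           (solve 6 (λ e b₀ b₂ c₀ c₁ c₂ → b₂ :- c₀ :* c₀ :* e :=
               (:- e) :* (b₀ :- c₀ :* c₀)
               :+ con (+ 1) :* (b₂ :+ e :* b₀ :- (c₁ :* c₁ :+ con (+ 2) :* (c₀ :* c₂)))
               :+ c₁ :* c₁ :+ con (+ 2) :* c₀ :* (c₂ :- e :* c₀))
             refl e b₀ b₂ c₀ c₁ c₂)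
           ((- e) ⊙ b₀≈c₀² ⊕ 1# ⊙ b₂+eb₀≈c₁²+2c₀c₂ ⊕ c₁ ⊙ c₁≈0 ⊕ ((1# + 1#) * c₀) ⊙ ζ≈0))))

    ζ≈0 : ζ ≈ 0#
    ζ≈0 = *-cancel c₁≉0 c₁ζ≈0

    e≈0 : e ≈ 0#
    e≈0 = *-cancel (*-≉0 c₁≉0 c₁≉0) (trans
      (solve 3 (λ c e ζ → c :* c :* e := con (+ 1) :* (c :* c :* e :- ζ :* ζ) :+ ζ :* ζ) refl c₁ e ζ)
      (1# ⊙ c₁²e≈ζ² ⊕ ζ ⊙ ζ≈0))

    -- Since e = 0, A is x²; the linear forms are l = x and m = c₀ x + c₁ y.
    C-split : (c₀ , c₁ , c₂) ≈Q (c₀ , c₁ , 0#)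
    C-split = refl , refl , trans
      (solve 3 (λ e c₀ c₂ → c₂ := con (+ 1) :* (c₂ :- e :* c₀) :+ c₀ :* e) refl e c₀ c₂)
      (1# ⊙ ζ≈0 ⊕ c₀ ⊙ e≈0)

    B-split : (b₀ , b₁ , b₂) ≈Q (c₀ * c₀ , (1# + 1#) * (c₀ * c₁) , c₁ * c₁)
    B-split = undifference b₀≈c₀² , undifference b₁≈2c₀c₁ , undifference (trans
      (solve 6 (λ e b₀ b₂ c₀ c₁ c₂ → b₂ :- c₁ :* c₁ :=
          con (+ 1) :* (b₂ :+ e :* b₀ :- (c₁ :* c₁ :+ con (+ 2) :* (c₀ :* c₂)))
          :+ con (+ 2) :* c₀ :* (c₂ :- e :* c₀) :+ (con (+ 2) :* c₀ :* c₀ :- b₀) :* e)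
        refl e b₀ b₂ c₀ c₁ c₂)
      (1# ⊙ b₂+eb₀≈c₁²+2c₀c₂ ⊕ ((1# + 1#) * c₀) ⊙ ζ≈0 ⊕ ((1# + 1#) * c₀ * c₀ - b₀) ⊙ e≈0))

-- Simultaneous splitting A = l², B = m², C = l m.

module Splittings {c ℓ} (R : CommutativeRing c ℓ) (isAlgClosed : Forms.IsAlgClosedFieldChar0 R) where
  open CommutativeRing R
  open Forms R
  open IsAlgClosedFieldChar0 isAlgClosed
  open IntegerSolver R
  open AlgClosedField R isAlgClosed
  open Quadratics R isAlgClosed

  linear : K → K → K → K → K
  linear l₀ l₁ x y = l₀ * x + l₁ * y

  linearᴾ : ∀ {n} → (l₀ l₁ x y : Polynomial n) → Polynomial n
  linearᴾ l₀ l₁ x y = l₀ :* x :+ l₁ :* y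

  product : (l₀ l₁ m₀ m₁ : K) → Quad
  product l₀ l₁ m₀ m₁ = l₀ * m₀ , l₀ * m₁ + l₁ * m₀ , l₁ * m₁

  productᴾ : ∀ {n} → (l₀ l₁ m₀ m₁ x y : Polynomial n) → Polynomial n
  productᴾ l₀ l₁ m₀ m₁ x y = evᴾ (l₀ :* m₀) (l₀ :* m₁ :+ l₁ :* m₀) (l₁ :* m₁) x y

  ev-product : ∀ l₀ l₁ m₀ m₁ x y → ev (product l₀ l₁ m₀ m₁) x y ≈ linear l₀ l₁ x y * linear m₀ m₁ x y
  ev-product = solve 6 (λ l₀ l₁ m₀ m₁ x y →
    productᴾ l₀ l₁ m₀ m₁ x y := linearᴾ l₀ l₁ x y :* linearᴾ m₀ m₁ x y) refl

  record Splitting (A B C : Quad) : Set (c ⊔ ℓ) where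
    field
      l₀ l₁ m₀ m₁ : K
      δ≉0 : ¬ (l₀ * m₁ - l₁ * m₀ ≈ 0#)
      A≈ll : A ≈Q product l₀ l₁ l₀ l₁
      B≈mm : B ≈Q product m₀ m₁ m₀ m₁
      C≈lm : C ≈Q product l₀ l₁ m₀ m₁

  -- The inverse of a matrix of determinant 1 is its adjugate, so (p, q) is the image of (w p - z q,
  -- x q - y p).
  ev-uncompose : ∀ f {g} x z y w → x * w - z * y ≈ 1# → compose f (lin x z y w) ≈Q g →
    ∀ p q → ev f p q ≈ ev g (w * p - z * q) (x * q - y * p)
  ev-uncompose f {g} x z y w unimodular f′≈g p q = trans
    (ev-arg-cong f
      (coordinate p (solve 6 (λ x y z w p q →
        p :- (x :* (w :* p :- z :* q) :+ z :* (x :* q :- y :* p)) := (:- p) :* (x :* w :- z :* y :- con (+ 1)))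
        refl x y z w p q))
      (coordinate q (solve 6 (λ x y z w p q →
        q :- (y :* (w :* p :- z :* q) :+ w :* (x :* q :- y :* p)) := (:- q) :* (x :* w :- z :* y :- con (+ 1)))
        refl x y z w p q)))
    (trans (sym (ev-compose f x z y w (w * p - z * q) (x * q - y * p))) (ev-cong f′≈g _ _))
    where
    coordinate : ∀ r {r′} → r - r′ ≈ (- r) * (x * w - z * y - 1#) → r ≈ r′
    coordinate r eq = undifference (trans eq ((- r) ⊙ difference unimodular))

  module Split (A B C : Quad)
    (CE≈0 : ∀ x y → ev C x y * (ev A x y * ev B x y - ev C x y * ev C x y) ≈ 0#)
    (not-collinear : ¬ (∃ λ k → (C ≈Q scaleQ k A) × (B ≈Q scaleQ (k * k) A)))
    where

    a₀ = proj₁ A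
    a₁ = proj₁ (proj₂ A)
    a₂ = proj₂ (proj₂ A)
    b₀ = proj₁ B
    b₂ = proj₂ (proj₂ B)
    c₀ = proj₁ C
    c₁ = proj₁ (proj₂ C)
    c₂ = proj₂ (proj₂ C)

    -- In the basis (x, y), (z, w) the form A is diagonal with leading coefficient 1, and the
    -- leading coefficient of C is its value at (x, y), hence nonzero.
    module Normalised (x z y w : K) (e : K) (unimodular : x * w - z * y ≈ 1#)
      (A′≈ : compose A (lin x z y w) ≈Q (1# , 0# , e))
      (C≉0 : ¬ (ev C x y ≈ 0#)) where

      M : LinChange
      M = lin x z y w

      A′ B′ C′ : Quad
      A′ = 1# , 0# , e
      B′ = compose B M
      C′ = compose C M

      C′E′≈0 : ∀ u v → ev C′ u v * (ev A′ u v * ev B′ u v - ev C′ u v * ev C′ u v) ≈ 0#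
      C′E′≈0 u v = trans
        (*-cong (ev-compose C x z y w u v)
          (+-cong (*-cong (trans (sym (ev-cong A′≈ u v)) (ev-compose A x z y w u v)) (ev-compose B x z y w u v))
            (-‿cong (*-cong (ev-compose C x z y w u v) (ev-compose C x z y w u v)))))
        (CE≈0 (x * u + z * v) (y * u + w * v))

      multiple : ∀ f k → compose f M ≈Q scaleQ k A′ → f ≈Q scaleQ k A
      multiple f k f′≈kA′ = ev-injective f (scaleQ k A) λ p q → trans
        (ev-uncompose f x z y w unimodular f′≈kA′ p q)
        (trans (ev-scaleQ k A′ _ _)
        (trans (*-congˡ (sym (ev-uncompose A x z y w unimodular A′≈ p q)))
               (sym (ev-scaleQ k A p q))))

      open Diagonal e (proj₁ B′) (proj₁ (proj₂ B′)) (proj₂ (proj₂ B′)) (proj₁ C′) (proj₁ (proj₂ C′)) (proj₂ (proj₂ C′))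
        C′E′≈0
        (λ (k , C′≈ , B′≈) → not-collinear (k , multiple C k C′≈ , multiple B (k * k) B′≈)) C≉0
        using (c₁≉0; e≈0; B-split; C-split)

      γ₀ γ₁ : K
      γ₀ = proj₁ C′
      γ₁ = proj₁ (proj₂ C′)

      splitting : Splitting A B C
      splitting = record
        -- The forms x and γ₀ x + γ₁ y carried back by the inverse of `M`; their determinant is γ₁.
        { l₀ = w ; l₁ = - z ; m₀ = γ₀ * w - γ₁ * y ; m₁ = γ₁ * x - γ₀ * z
        ; δ≉0 = λ δ≈0 → c₁≉0 (trans
            (solve 6 (λ γ₀ γ₁ x y z w → γ₁ :=
                con (+ 1) :* (w :* (γ₁ :* x :- γ₀ :* z) :- (:- z) :* (γ₀ :* w :- γ₁ :* y))
                :+ (:- γ₁) :* (x :* w :- z :* y :- con (+ 1)))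
              refl γ₀ γ₁ x y z w)
            (1# ⊙ δ≈0 ⊕ (- γ₁) ⊙ difference unimodular))
        ; A≈ll = ev-injective A (product w (- z) w (- z)) λ p q → trans
            (ev-uncompose A {1# , 0# , 0#} x z y w unimodular
              (proj₁ A′≈ , proj₁ (proj₂ A′≈) , trans (proj₂ (proj₂ A′≈)) e≈0) p q)
            (solve 6 (λ x y z w p q →
                evᴾ (con (+ 1)) (con (+ 0)) (con (+ 0)) (w :* p :- z :* q) (x :* q :- y :* p)
                := productᴾ w (:- z) w (:- z) p q) refl x y z w p q)
        ; B≈mm = ev-injective B (product (γ₀ * w - γ₁ * y) (γ₁ * x - γ₀ * z) (γ₀ * w - γ₁ * y) (γ₁ * x - γ₀ * z))
            λ p q → trans
            (ev-uncompose B x z y w unimodular B-split p q)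
            (solve 8 (λ γ₀ γ₁ x y z w p q →
                let m₀ = γ₀ :* w :- γ₁ :* y
                    m₁ = γ₁ :* x :- γ₀ :* z in
                evᴾ (γ₀ :* γ₀) (con (+ 2) :* (γ₀ :* γ₁)) (γ₁ :* γ₁) (w :* p :- z :* q) (x :* q :- y :* p)
                := productᴾ m₀ m₁ m₀ m₁ p q) refl γ₀ γ₁ x y z w p q)
        ; C≈lm = ev-injective C (product w (- z) (γ₀ * w - γ₁ * y) (γ₁ * x - γ₀ * z)) λ p q → trans
            (ev-uncompose C x z y w unimodular C-split p q)
            (solve 8 (λ γ₀ γ₁ x y z w p q →
                let m₀ = γ₀ :* w :- γ₁ :* y
                    m₁ = γ₁ :* x :- γ₀ :* z in
                evᴾ γ₀ γ₁ (con (+ 0)) (w :* p :- z :* q) (x :* q :- y :* p)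
                := productᴾ w (:- z) m₀ m₁ p q) refl γ₀ γ₁ x y z w p q)
        }

    ev-scale-point : ∀ f r x y → ev f (r * x) (r * y) ≈ r * r * ev f x y
    ev-scale-point (a , b , d) = solve 6 (λ a b d r x y → evᴾ a b d (r :* x) (r :* y) := r :* r :* evᴾ a b d x y)
      refl a b d

    -- Where C ≠ 0 the relation gives A B = C², so A ≠ 0. Dividing the point by a square root of A
    -- makes its A-value 1, and an A-orthogonal second vector makes A diagonal.
    splitting-at : ∀ x y → ¬ (ev C x y ≈ 0#) → Splitting A B C
    splitting-at x y C≉0 = Normalised.splitting x′ z y′ w (ev A z w) unimodular (A≈1 , polar≈0 , refl) C′≉0
      where
      α γ : K
      α = ev A x y
      γ = ev C x y

      α≉0 : ¬ (α ≈ 0#)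
      α≉0 α≈0 = *-≉0 C≉0 C≉0 (trans
        (solve 3 (λ α β γ → γ :* γ := con -[1+ 0 ] :* (α :* β :- γ :* γ) :+ β :* α) refl α (ev B x y) γ)
        ((- 1#) ⊙ *-cancel C≉0 (CE≈0 x y) ⊕ ev B x y ⊙ α≈0))

      r = proj₁ (squareRoot α)
      r²≈α = proj₂ (squareRoot α)
      r≉0 : ¬ (r ≈ 0#)
      r≉0 r≈0 = α≉0 (trans (sym r²≈α) (r ⊙ r≈0))
      ρ = proj₁ (inverse r r≉0)
      rρ≈1 = proj₂ (inverse r r≉0)

      half : K
      half = proj₁ (inverse (1# + 1#) (n·1≉0 1))

      -- (z , w) is A-orthogonal to (x′ , y′), scaled to make the two a unimodular basis.
      x′ y′ z w : K
      x′ = ρ * x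
      y′ = ρ * y
      z = - ((a₁ * x′ + (1# + 1#) * a₂ * y′) * half)
      w = ((1# + 1#) * a₀ * x′ + a₁ * y′) * half

      A≈1 : ev A x′ y′ ≈ 1#
      A≈1 = trans (ev-scale-point A ρ x y) (undifference (trans
        (solve 3 (λ α r ρ → ρ :* ρ :* α :- con (+ 1) :=
            (:- (ρ :* ρ)) :* (r :* r :- α) :+ (r :* ρ :+ con (+ 1)) :* (r :* ρ :- con (+ 1))) refl α r ρ)
        ((- (ρ * ρ)) ⊙ difference r²≈α ⊕ (r * ρ + 1#) ⊙ difference rρ≈1)))

      C′≉0 : ¬ (ev C x′ y′ ≈ 0#)
      C′≉0 C′≈0 = *-≉0 (*-≉0 ρ≉0 ρ≉0) C≉0 (trans (sym (ev-scale-point C ρ x y)) C′≈0)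
        where
        ρ≉0 : ¬ (ρ ≈ 0#)
        ρ≉0 ρ≈0 = nontrivial (trans (sym rρ≈1) (r ⊙ ρ≈0))

      unimodular : x′ * w - z * y′ ≈ 1#
      unimodular = undifference (trans
        (solve 6 (λ a b d x y h →
            x :* ((con (+ 2) :* a :* x :+ b :* y) :* h) :- (:- ((b :* x :+ con (+ 2) :* d :* y) :* h)) :* y :- con (+ 1)
            := evᴾ a b d x y :* (con (+ 2) :* h :- con (+ 1)) :+ (con (+ 1)) :* (evᴾ a b d x y :- con (+ 1)))
          refl a₀ a₁ a₂ x′ y′ half)
        (ev A x′ y′ ⊙ difference (proj₂ (inverse (1# + 1#) (n·1≉0 1))) ⊕ 1# ⊙ difference A≈1))

      polar≈0 : proj₁ (proj₂ (compose A (lin x′ z y′ w))) ≈ 0#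
      polar≈0 = solve 6 (λ a b d x y h →
          let z = :- ((b :* x :+ con (+ 2) :* d :* y) :* h)
              w = (con (+ 2) :* a :* x :+ b :* y) :* h in
          con (+ 2) :* a :* (x :* z) :+ b :* (x :* w :+ z :* y) :+ con (+ 2) :* d :* (y :* w) := con (+ 0))
        refl a₀ a₁ a₂ x′ y′ half

    -- A point with C ≠ 0, built without case distinctions.

    module _ (C≉0 : ¬ (C ≈Q (0# , 0# , 0#))) where

      -- Without a splitting, C could be nonzero at none of (1, 0), (0, 1), (1, 1), and its values
      -- there determine it. Which of them is nonzero is undecided, hence the double negation.
      splitting-exists : ¬ ¬ Splitting A B C
      splitting-exists none =
        vanishes 1# 0# λ c₀≈0 → vanishes 0# 1# λ c₂≈0 → vanishes 1# 1# λ s≈0 → C≉0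
          ( trans (solve 3 (λ a b d → a := evᴾ a b d (con (+ 1)) (con (+ 0))) refl c₀ c₁ c₂) c₀≈0
          , trans
              (solve 3 (λ a b d → b := con (+ 1) :* evᴾ a b d (con (+ 1)) (con (+ 1))
                  :+ con -[1+ 0 ] :* evᴾ a b d (con (+ 1)) (con (+ 0))
                  :+ con -[1+ 0 ] :* evᴾ a b d (con (+ 0)) (con (+ 1))) refl c₀ c₁ c₂)
              (1# ⊙ s≈0 ⊕ (- 1#) ⊙ c₀≈0 ⊕ (- 1#) ⊙ c₂≈0)
          , trans (solve 3 (λ a b d → d := evᴾ a b d (con (+ 0)) (con (+ 1))) refl c₀ c₁ c₂) c₂≈0 )
        where
        vanishes : ∀ x y → ¬ ¬ (ev C x y ≈ 0#)
        vanishes x y value≉0 = none (splitting-at x y value≉0)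

      -- Any square roots serve: with x₀² = s₀ and y₀² = - s₂, the sum a₀ s₀ + a₂ s₂ becomes the
      -- difference of squares l₀² x₀² - l₁² y₀².
      χ υ s₀ s₂ x₀ y₀ : K
      χ = a₀ * b₂ + a₂ * b₀
      υ = χ - (1# + 1# + 1# + 1#) * (c₀ * c₂)
      s₀ = b₂ * υ + (1# + 1# + 1# + 1#) * (b₀ * (c₂ * c₂))
      s₂ = b₀ * υ
      x₀ = proj₁ (squareRoot s₀)
      y₀ = proj₁ (squareRoot (- s₂))

      -- If A = l², B = m² and C = l m then a₀ s₀ + a₂ s₂ = (χ − 2 c₀ c₂)² = (l₀ m₁ − l₁ m₀)⁴,
      -- and l (x₀ , y₀) divides this number.
      A₀≉0 : ¬ (ev A x₀ y₀ ≈ 0#)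
      A₀≉0 A₀≈0 = splitting-exists λ s → l≉0 s (A₀≈l² s)
        where
        module _ (s : Splitting A B C) where
          open Splitting s

          δ l l̄ χ′ υ′ s₀′ s₂′ : K
          δ = l₀ * m₁ - l₁ * m₀
          l = linear l₀ l₁ x₀ y₀
          l̄ = linear l₀ (- l₁) x₀ y₀
          χ′ = l₀ * l₀ * (m₁ * m₁) + l₁ * l₁ * (m₀ * m₀)
          υ′ = χ′ - (1# + 1# + 1# + 1#) * (l₀ * m₀ * (l₁ * m₁))
          s₀′ = m₁ * m₁ * υ′ + (1# + 1# + 1# + 1#) * (m₀ * m₀ * (l₁ * m₁ * (l₁ * m₁)))
          s₂′ = m₀ * m₀ * υ′

          υ≈υ′ : υ ≈ υ′
          υ≈υ′ = +-cong
            (+-cong (*-cong (proj₁ A≈ll) (proj₂ (proj₂ B≈mm))) (*-cong (proj₂ (proj₂ A≈ll)) (proj₁ B≈mm)))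
            (-‿cong (*-congˡ (*-cong (proj₁ C≈lm) (proj₂ (proj₂ C≈lm)))))

          x₀²≈s₀′ : x₀ * x₀ ≈ s₀′
          x₀²≈s₀′ = trans (proj₂ (squareRoot s₀)) (+-cong
            (*-cong (proj₂ (proj₂ B≈mm)) υ≈υ′)
            (*-congˡ (*-cong (proj₁ B≈mm) (*-cong (proj₂ (proj₂ C≈lm)) (proj₂ (proj₂ C≈lm))))))

          y₀²≈-s₂′ : y₀ * y₀ ≈ - s₂′
          y₀²≈-s₂′ = trans (proj₂ (squareRoot (- s₂))) (-‿cong (*-cong (proj₁ B≈mm) υ≈υ′))

          ll̄≈δ⁴ : l * l̄ ≈ δ * δ * (δ * δ)
          ll̄≈δ⁴ = trans
            (solve 4 (λ l₀ l₁ x y → linearᴾ l₀ l₁ x y :* linearᴾ l₀ (:- l₁) x y :=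
              l₀ :* l₀ :* (x :* x) :- l₁ :* l₁ :* (y :* y)) refl l₀ l₁ x₀ y₀)
            (trans (+-cong (*-congˡ x₀²≈s₀′) (-‿cong (*-congˡ y₀²≈-s₂′)))
            (solve 4 (λ l₀ l₁ m₀ m₁ →
                let δ = l₀ :* m₁ :- l₁ :* m₀
                    υ = l₀ :* l₀ :* (m₁ :* m₁) :+ l₁ :* l₁ :* (m₀ :* m₀) :- con (+ 4) :* (l₀ :* m₀ :* (l₁ :* m₁)) in
                l₀ :* l₀ :* (m₁ :* m₁ :* υ :+ con (+ 4) :* (m₀ :* m₀ :* (l₁ :* m₁ :* (l₁ :* m₁))))
                :- l₁ :* l₁ :* (:- (m₀ :* m₀ :* υ)) := δ :* δ :* (δ :* δ))
              refl l₀ l₁ m₀ m₁))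

          A₀≈l² : l * l ≈ 0#
          A₀≈l² = trans (sym (trans (ev-cong A≈ll x₀ y₀) (ev-product l₀ l₁ l₀ l₁ x₀ y₀))) A₀≈0

          l≉0 : ¬ (l * l ≈ 0#)
          l≉0 = *-≉0 l≉ l≉
            where
            δ²≉0 = *-≉0 δ≉0 δ≉0
            l≉ : ¬ (l ≈ 0#)
            l≉ = *-≉0ˡ λ ll̄≈0 → *-≉0 δ²≉0 δ²≉0 (trans (sym ll̄≈δ⁴) ll̄≈0)

      -- (z , w) is A-orthogonal to (x₀ , y₀); pointwise it spans the kernel of l, so C vanishes there and
      -- C (ε x₀ + τ z , ε y₀ + τ w) = ε² (C (x₀ , y₀) + τ).
      z w ε τ x₁ y₁ : K
      z = - (a₁ * x₀ + (1# + 1#) * a₂ * y₀)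
      w = (1# + 1#) * a₀ * x₀ + a₁ * y₀
      ε = (1# + 1#) * c₀ * (x₀ * z) + c₁ * (x₀ * w + z * y₀) + (1# + 1#) * c₂ * (y₀ * w)
      τ = 1# - ev C x₀ y₀
      x₁ = ε * x₀ + τ * z
      y₁ = ε * y₀ + τ * w

      module _ (s : Splitting A B C) where
        open Splitting s

        δ l : K
        δ = l₀ * m₁ - l₁ * m₀
        l = linear l₀ l₁ x₀ y₀

        l≉0 : ¬ (l ≈ 0#)
        l≉0 l≈0 = A₀≉0 (trans (ev-cong A≈ll x₀ y₀) (trans (ev-product l₀ l₁ l₀ l₁ x₀ y₀) (l ⊙ l≈0)))

        -- For A = l² the vector (z, w) is 2 l (x₀, y₀) times (- l₁, l₀). This also gives the value
        -- of m there.
        l-zero : linear l₀ l₁ z w ≈ 0#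
        l-zero = trans
          (solve 7 (λ l₀ l₁ a b d x y →
              linearᴾ l₀ l₁ (:- (b :* x :+ con (+ 2) :* d :* y)) (con (+ 2) :* a :* x :+ b :* y) :=
              con (+ 2) :* l₁ :* x :* (a :- l₀ :* l₀)
              :+ (l₁ :* y :- l₀ :* x) :* (b :- (l₀ :* l₁ :+ l₁ :* l₀))
              :+ (:- (con (+ 2) :* l₀ :* y)) :* (d :- l₁ :* l₁)) refl l₀ l₁ a₀ a₁ a₂ x₀ y₀)
          (_ ⊙ difference (proj₁ A≈ll) ⊕ _ ⊙ difference (proj₁ (proj₂ A≈ll)) ⊕ _ ⊙ difference (proj₂ (proj₂ A≈ll)))

        m-value : linear m₀ m₁ z w - (1# + 1#) * (l * δ) ≈ 0#
        m-value = trans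
          (solve 9 (λ l₀ l₁ m₀ m₁ a b d x y →
              linearᴾ m₀ m₁ (:- (b :* x :+ con (+ 2) :* d :* y)) (con (+ 2) :* a :* x :+ b :* y)
              :- con (+ 2) :* (linearᴾ l₀ l₁ x y :* (l₀ :* m₁ :- l₁ :* m₀)) :=
              con (+ 2) :* m₁ :* x :* (a :- l₀ :* l₀)
              :+ (m₁ :* y :- m₀ :* x) :* (b :- (l₀ :* l₁ :+ l₁ :* l₀))
              :+ (:- (con (+ 2) :* m₀ :* y)) :* (d :- l₁ :* l₁)) refl l₀ l₁ m₀ m₁ a₀ a₁ a₂ x₀ y₀)
          (_ ⊙ difference (proj₁ A≈ll) ⊕ _ ⊙ difference (proj₁ (proj₂ A≈ll)) ⊕ _ ⊙ difference (proj₂ (proj₂ A≈ll)))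

        C-zero : ev C z w ≈ 0#
        C-zero = trans (ev-cong C≈lm z w) (trans (ev-product l₀ l₁ m₀ m₁ z w)
          (trans (*-comm _ _) (linear m₀ m₁ z w ⊙ l-zero)))

        -- As the polarisation of C = l m, ε is l (x₀, y₀) m (z, w) + l (z, w) m (x₀, y₀), and the
        -- second term vanishes.
        ε-value : ε ≈ (1# + 1#) * (l * l * δ)
        ε-value = undifference (trans
          (solve 11 (λ l₀ l₁ m₀ m₁ c₀ c₁ c₂ x y z w →
              let l = linearᴾ l₀ l₁ x y
                  δ = l₀ :* m₁ :- l₁ :* m₀ in
              con (+ 2) :* c₀ :* (x :* z) :+ c₁ :* (x :* w :+ z :* y) :+ con (+ 2) :* c₂ :* (y :* w)
              :- con (+ 2) :* (l :* l :* δ)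
              := con (+ 2) :* (x :* z) :* (c₀ :- l₀ :* m₀)
              :+ (x :* w :+ z :* y) :* (c₁ :- (l₀ :* m₁ :+ l₁ :* m₀))
              :+ con (+ 2) :* (y :* w) :* (c₂ :- l₁ :* m₁)
              :+ l :* (linearᴾ m₀ m₁ z w :- con (+ 2) :* (l :* δ))
              :+ linearᴾ m₀ m₁ x y :* linearᴾ l₀ l₁ z w) refl l₀ l₁ m₀ m₁ c₀ c₁ c₂ x₀ y₀ z w)
          (_ ⊙ difference (proj₁ C≈lm) ⊕ _ ⊙ difference (proj₁ (proj₂ C≈lm)) ⊕ _ ⊙ difference (proj₂ (proj₂ C≈lm))
           ⊕ _ ⊙ m-value ⊕ _ ⊙ l-zero))

        ε≉0 : ¬ (ε ≈ 0#)
        ε≉0 ε≈0 = *-≉0 {1# + 1#} (n·1≉0 1) (*-≉0 (*-≉0 l≉0 l≉0) δ≉0) (trans (sym ε-value) ε≈0)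

      -- The choice of τ makes the value ε². The claim is a negation, so a splitting known only up
      -- to double negation may be used.
      C₁≉0 : ¬ (ev C x₁ y₁ ≈ 0#)
      C₁≉0 C₁≈0 = splitting-exists λ s → *-≉0 (ε≉0 s) (ε≉0 s) (trans
        (solve 7 (λ c₀ c₁ c₂ x y z w →
            let ε = con (+ 2) :* c₀ :* (x :* z) :+ c₁ :* (x :* w :+ z :* y) :+ con (+ 2) :* c₂ :* (y :* w)
                τ = con (+ 1) :- evᴾ c₀ c₁ c₂ x y in
            ε :* ε := con (+ 1) :* evᴾ c₀ c₁ c₂ (ε :* x :+ τ :* z) (ε :* y :+ τ :* w)
              :+ (:- (τ :* τ)) :* evᴾ c₀ c₁ c₂ z w)
          refl c₀ c₁ c₂ x₀ y₀ z w)
        (1# ⊙ C₁≈0 ⊕ (- (τ * τ)) ⊙ C-zero s))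

      -- The explicit point (x₁, y₁) removes the double negation of `splitting-exists`.
      splitting : Splitting A B C
      splitting = splitting-at x₁ y₁ C₁≉0

-- From coefficients of cubes to values of cubes.

module Sextics {c ℓ} (R : CommutativeRing c ℓ) (isAlgClosed : Forms.IsAlgClosedFieldChar0 R) where
  open CommutativeRing R
  open Forms R
  open IntegerSolver R
  open Quadratics R isAlgClosed

  evF : Form → K → K → K
  evF []      x y = 0#
  evF (a ∷ p) x y = a * pow x (length p) + y * evF p x y

  evF-cong : ∀ {p q} → p ≈F q → ∀ x y → evF p x y ≈ evF q x y
  evF-cong []          x y = refl
  evF-cong (a≈b ∷ p≈q) x y =
    +-cong (*-cong a≈b (reflexive (≡.cong (pow x) (Pointwise-length p≈q)))) (*-congˡ (evF-cong p≈q x y))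

  -- Lists of unequal length are forms of different degrees, which `addF` would align at their
  -- leading x-terms.
  evF-addF : ∀ p q → length p ≡ length q → ∀ x y → evF (addF p q) x y ≈ evF p x y + evF q x y
  evF-addF []      []      _  x y = sym (+-identityˡ 0#)
  evF-addF (a ∷ p) (b ∷ q) eq x y = trans
    (+-cong
      (*-congˡ (reflexive (≡.cong (pow x) (length-addF p q (ℕ.suc-injective eq)))))
      (*-congˡ (evF-addF p q (ℕ.suc-injective eq) x y)))
    (trans
      (solve 6 (λ a b X y u v → (a :+ b) :* X :+ y :* (u :+ v) := (a :* X :+ y :* u) :+ (b :* X :+ y :* v))
        refl a b (pow x (length p)) y (evF p x y) (evF q x y))
      (+-congˡ (+-congʳ (*-congˡ (reflexive (≡.cong (pow x) (ℕ.suc-injective eq)))))))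
    where
    length-addF : ∀ p q → length p ≡ length q → length (addF p q) ≡ length p
    length-addF []      []      _  = ≡.refl
    length-addF (a ∷ p) (b ∷ q) eq = ≡.cong suc (length-addF p q (ℕ.suc-injective eq))

  -- At fixed length `mulF` computes, and the solver's left side copies its result, added zeros
  -- included. A cube needs only second factors of length 3 and 5.
  evF-mulF₃ : ∀ a b d q₀ q₁ q₂ x y → let q = q₀ ∷ q₁ ∷ q₂ ∷ [] in
    evF (mulF (quad a b d) q) x y ≈ ev (a , b , d) x y * evF q x y
  evF-mulF₃ = solve 8 (λ a b d q₀ q₁ q₂ x y →
    let o = con (+ 0) in
    (a :* q₀ :+ o) :* x :^ 4 :+ y :* ((a :* q₁ :+ (b :* q₀ :+ o)) :* x :^ 3 :+ y :*
      ((a :* q₂ :+ (b :* q₁ :+ (d :* q₀ :+ o))) :* x :^ 2 :+ y :* ((b :* q₂ :+ d :* q₁) :* x :^ 1 :+ y :*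
      ((d :* q₂) :* x :^ 0 :+ y :* o))))
    := evᴾ a b d x y :* (q₀ :* x :^ 2 :+ y :* (q₁ :* x :^ 1 :+ y :* (q₂ :* x :^ 0 :+ y :* o)))) refl

  evF-mulF₅ : ∀ a b d q₀ q₁ q₂ q₃ q₄ x y → let q = q₀ ∷ q₁ ∷ q₂ ∷ q₃ ∷ q₄ ∷ [] in
    evF (mulF (quad a b d) q) x y ≈ ev (a , b , d) x y * evF q x y
  evF-mulF₅ = solve 10 (λ a b d q₀ q₁ q₂ q₃ q₄ x y →
    let o = con (+ 0) in
    (a :* q₀ :+ o) :* x :^ 6 :+ y :* ((a :* q₁ :+ (b :* q₀ :+ o)) :* x :^ 5 :+ y :*
      ((a :* q₂ :+ (b :* q₁ :+ (d :* q₀ :+ o))) :* x :^ 4 :+ y :* ((a :* q₃ :+ (b :* q₂ :+ d :* q₁)) :* x :^ 3 :+ y :*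
      ((a :* q₄ :+ (b :* q₃ :+ d :* q₂)) :* x :^ 2 :+ y :* ((b :* q₄ :+ d :* q₃) :* x :^ 1 :+ y :*
      ((d :* q₄) :* x :^ 0 :+ y :* o))))))
    := evᴾ a b d x y :* (q₀ :* x :^ 4 :+ y :* (q₁ :* x :^ 3 :+ y :* (q₂ :* x :^ 2 :+ y :*
      (q₃ :* x :^ 1 :+ y :* (q₄ :* x :^ 0 :+ y :* o)))))) refl

  evF-toF : ∀ f x y → evF (toF f) x y ≈ ev f x y
  evF-toF (a , b , d) = solve 5 (λ a b d x y →
    a :* x :^ 2 :+ y :* (b :* x :^ 1 :+ y :* (d :* x :^ 0 :+ y :* con (+ 0))) := evᴾ a b d x y) refl a b d

  cube : K → K
  cube u = u * (u * u)

  evF-cubeF : ∀ f x y → evF (cubeF (toF f)) x y ≈ cube (ev f x y)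
  evF-cubeF f@(a , b , d) x y = trans (evF-mulF₅ a b d _ _ _ _ _ x y)
    (*-congˡ (trans (evF-mulF₃ a b d a b d x y) (*-congˡ (evF-toF f x y))))

  sum-of-cubes : ∀ f g h k →
    addF (cubeF (toF f)) (cubeF (toF g)) ≈F addF (cubeF (toF h)) (cubeF (toF k)) →
    ∀ x y → cube (ev f x y) + cube (ev g x y) ≈ cube (ev h x y) + cube (ev k x y)
  sum-of-cubes f g h k eq x y = trans (sym (side f g)) (trans (evF-cong eq x y) (side h k))
    where
    side : ∀ f g → evF (addF (cubeF (toF f)) (cubeF (toF g))) x y ≈ cube (ev f x y) + cube (ev g x y)
    side f g = trans (evF-addF (cubeF (toF f)) (cubeF (toF g)) ≡.refl x y) (+-cong (evF-cubeF f x y) (evF-cubeF g x y))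

-- The four forms expressed through A, B, C, and the change of variables.

module Parametrisation {c ℓ} (R : CommutativeRing c ℓ) (isAlgClosed : Forms.IsAlgClosedFieldChar0 R) where
  open CommutativeRing R
  open Forms R
  open IsAlgClosedFieldChar0 isAlgClosed
  open IntegerSolver R
  open AlgClosedField R isAlgClosed
  open Quadratics R isAlgClosed
  open Splittings R isAlgClosed
  open Sextics R isAlgClosed

  module Solution
    (ω : K) (ω³≈1 : pow ω 3 ≈ 1#) (ω≉1 : ¬ (ω ≈ 1#))
    (f₁ f₂ f₃ f₄ : K × K × K)
    (f₃∦f₄ : ¬ Proportional f₃ f₄)
    (cubes : addF (cubeF (toF f₁)) (cubeF (toF f₂)) ≈F addF (cubeF (toF f₃)) (cubeF (toF f₄)))
    (T : K) (sums : addF (toF f₁) (toF f₂) ≈F scaleF T (addF (toF f₃) (toF f₄)))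
    (T-generic : ¬ (T * (pow T 3 - 1#) ≈ 0#))
    (λ′ : K) (λ²≈T : λ′ * λ′ ≈ T)
    where

    2# 4# : K
    2# = 1# + 1#
    4# = 2# + 1# + 1#

    ω²+ω+1≈0 : ω * ω + ω + 1# ≈ 0#
    ω²+ω+1≈0 = *-cancel {ω - 1#} (λ z → ω≉1 (undifference z)) (trans
      (solve 1 (λ ω → (ω :- con (+ 1)) :* (ω :* ω :+ ω :+ con (+ 1)) := ω :^ 3 :- con (+ 1)) refl ω)
      (difference ω³≈1))

    -- For the special forms themselves, U = g (x − y)², V = h (x + y)² and s = j (x − y) (x + y).
    g h j : K
    g = pow λ′ 4 - λ′
    h = - (pow λ′ 4 + λ′)
    j = λ′ * (pow ω 2 - ω)

    -- The product is g h = - T (T³ - 1).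
    gh≉0 : ¬ (g * h ≈ 0#)
    gh≉0 gh≈0 = T-generic (trans
      (*-cong (sym λ²≈T) (+-congʳ (*-cong (sym λ²≈T) (*-cong (sym λ²≈T) (*-congʳ (sym λ²≈T))))))
      (trans
        (solve 1 (λ λ′ → (λ′ :* λ′) :* ((λ′ :* λ′) :^ 3 :- con (+ 1)) :=
          con -[1+ 0 ] :* ((λ′ :^ 4 :- λ′) :* (:- (λ′ :^ 4 :+ λ′)))) refl λ′)
        ((- 1#) ⊙ gh≈0)))

    -- Since (ω² - ω)² = - 3, both sides are - 3 λ² (λ⁶ - 1).
    3gh≈λj² : (1# + 1# + 1#) * (g * h) ≈ (pow λ′ 6 - 1#) * (j * j)
    3gh≈λj² = undifference (trans
      (solve 2 (λ λ′ ω →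
          let j = λ′ :* (ω :^ 2 :- ω) in
          con (+ 3) :* ((λ′ :^ 4 :- λ′) :* (:- (λ′ :^ 4 :+ λ′))) :- (λ′ :^ 6 :- con (+ 1)) :* (j :* j) :=
          (:- ((λ′ :^ 6 :- con (+ 1)) :* (λ′ :* λ′) :* (ω :* ω :- con (+ 3) :* ω :+ con (+ 3))))
          :* (ω :* ω :+ ω :+ con (+ 1))) refl λ′ ω)
      (_ ⊙ ω²+ω+1≈0))

    j≉0 : ¬ (j ≈ 0#)
    j≉0 j≈0 = *-≉0 {1# + 1# + 1#} (n·1≉0 2) gh≉0
      (trans 3gh≈λj² (_ ⊙ (j ⊙ j≈0)))

    λ≉0 : ¬ (λ′ ≈ 0#)
    λ≉0 λ≈0 = j≉0 (trans (*-comm _ _) (_ ⊙ λ≈0))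

    g⁻¹ h⁻¹ j⁻¹ : K
    g⁻¹ = proj₁ (inverse g (*-≉0ˡ gh≉0))
    h⁻¹ = proj₁ (inverse h (*-≉0ʳ gh≉0))
    j⁻¹ = proj₁ (inverse j j≉0)

    infixr 6 _+Q_
    infixr 7 _*Q_
    _+Q_ = addQ
    _*Q_ = scaleQ

    -- Division by g, h and j absorbs the constants: the equation between the cubes becomes C (A B -
    -- C²) = 0.
    U V S A B C : Quad
    U = f₃ +Q (- 1#) *Q f₄ +Q (- λ′) *Q f₁ +Q λ′ *Q f₂
    V = f₃ +Q (- 1#) *Q f₄ +Q λ′ *Q f₁ +Q (- λ′) *Q f₂
    S = f₃ +Q f₄
    A = g⁻¹ *Q U
    B = h⁻¹ *Q V
    C = j⁻¹ *Q S

    module Values (x y : K) where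
      u₁ u₂ u₃ u₄ s p q : K
      u₁ = ev f₁ x y
      u₂ = ev f₂ x y
      u₃ = ev f₃ x y
      u₄ = ev f₄ x y
      s = u₃ + u₄
      p = u₁ - u₂
      q = u₃ - u₄

      unscale : ∀ {k k⁻¹} F {v} → k * k⁻¹ ≈ 1# → ev F x y ≈ v → k * ev (k⁻¹ *Q F) x y ≈ v
      unscale {k} {k⁻¹} F kk⁻¹≈1 F≈v = trans (*-congˡ (ev-scaleQ k⁻¹ F x y))
        (trans (sym (*-assoc _ _ _)) (trans (*-congʳ kk⁻¹≈1) (trans (*-identityˡ _) F≈v)))

      ev-combination : ∀ k l m → ev (f₃ +Q k *Q f₄ +Q l *Q f₁ +Q m *Q f₂) x y ≈ u₃ + (k * u₄ + (l * u₁ + m * u₂))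
      ev-combination k l m = trans (ev-addQ f₃ _ x y) (+-congˡ
        (trans (ev-addQ (k *Q f₄) _ x y) (+-cong (ev-scaleQ k f₄ x y)
        (trans (ev-addQ (l *Q f₁) (m *Q f₂) x y) (+-cong (ev-scaleQ l f₁ x y) (ev-scaleQ m f₂ x y))))))

      gA≈ : g * ev A x y ≈ q - λ′ * p
      gA≈ = unscale U (proj₂ (inverse g (*-≉0ˡ gh≉0))) (trans (ev-combination (- 1#) (- λ′) λ′)
        (solve 5 (λ λ′ u₁ u₂ u₃ u₄ → u₃ :+ (con -[1+ 0 ] :* u₄ :+ ((:- λ′) :* u₁ :+ λ′ :* u₂))
          := u₃ :- u₄ :- λ′ :* (u₁ :- u₂)) refl λ′ u₁ u₂ u₃ u₄))

      hB≈ : h * ev B x y ≈ q + λ′ * p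
      hB≈ = unscale V (proj₂ (inverse h (*-≉0ʳ gh≉0))) (trans (ev-combination (- 1#) λ′ (- λ′))
        (solve 5 (λ λ′ u₁ u₂ u₃ u₄ → u₃ :+ (con -[1+ 0 ] :* u₄ :+ (λ′ :* u₁ :+ (:- λ′) :* u₂))
          := u₃ :- u₄ :+ λ′ :* (u₁ :- u₂)) refl λ′ u₁ u₂ u₃ u₄))

      jC≈ : j * ev C x y ≈ s
      jC≈ = unscale S (proj₂ (inverse j j≉0)) (ev-addQ f₃ f₄ x y)

      sum : u₁ + u₂ ≈ λ′ * λ′ * s
      sum = trans (sym (ev-addQ f₁ f₂ x y))
        (trans (ev-cong (coefficients sums) x y)
        (trans (ev-scaleQ T (addQ f₃ f₄) x y) (*-cong (sym λ²≈T) (ev-addQ f₃ f₄ x y))))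
        where
        coefficients : ∀ {f g} → toF f ≈F toF g → f ≈Q g
        coefficients (a≈ ∷ b≈ ∷ d≈ ∷ []) = a≈ , b≈ , d≈

      -- 4 (u³ + v³) = (u + v) ((u + v)² + 3 (u − v)²) on both sides of the equation between the cubes.
      s-factor : s * ((pow λ′ 6 - 1#) * (s * s) - (1# + 1# + 1#) * ((q - λ′ * p) * (q + λ′ * p))) ≈ 0#
      s-factor = trans
        (solve 5 (λ λ′ u₁ u₂ u₃ u₄ →
            let s = u₃ :+ u₄
                p = u₁ :- u₂
                q = u₃ :- u₄
                σ = λ′ :* λ′ :* s
                Σ = u₁ :+ u₂
                cube = λ u → u :* (u :* u) in
            s :* ((λ′ :^ 6 :- con (+ 1)) :* (s :* s) :- con (+ 3) :* ((q :- λ′ :* p) :* (q :+ λ′ :* p)))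
            := con (+ 4) :* (cube u₁ :+ cube u₂ :- (cube u₃ :+ cube u₄))
            :+ (:- (Σ :* Σ :+ Σ :* σ :+ σ :* σ :+ con (+ 3) :* (p :* p))) :* (Σ :- σ)) refl λ′ u₁ u₂ u₃ u₄)
        (_ ⊙ difference (sum-of-cubes f₁ f₂ f₃ f₄ cubes x y) ⊕ _ ⊙ difference sum)

      -- Multiplying `s-factor` by j² turns (λ⁶ - 1) j² into 3 g h, after which 3 cancels.
      s-factor′ : s * (j * j * ((q - λ′ * p) * (q + λ′ * p)) - g * h * (s * s)) ≈ 0#
      s-factor′ = *-cancel {1# + 1# + 1#} (n·1≉0 2) (trans
        (solve 6 (λ s L j gh a b →
            con (+ 3) :* (s :* (j :* j :* (a :* b) :- gh :* (s :* s)))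
            := (:- (j :* j)) :* (s :* (L :* (s :* s) :- con (+ 3) :* (a :* b)))
            :+ (:- (s :* (s :* s))) :* (con (+ 3) :* gh :- L :* (j :* j)))
          refl s (pow λ′ 6 - 1#) j (g * h) (q - λ′ * p) (q + λ′ * p))
        (_ ⊙ s-factor ⊕ _ ⊙ difference 3gh≈λj²))

      CE≈0 : ev C x y * (ev A x y * ev B x y - ev C x y * ev C x y) ≈ 0#
      CE≈0 = *-cancel (*-≉0 gh≉0 (*-≉0 j≉0 (*-≉0 j≉0 j≉0))) (trans
        (solve 6 (λ g h j a b c →
            g :* h :* (j :* (j :* j)) :* (c :* (a :* b :- c :* c))
            := j :* c :* (j :* j :* (g :* a :* (h :* b)) :- g :* h :* (j :* c :* (j :* c))))
          refl g h j (ev A x y) (ev B x y) (ev C x y))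
        (trans
          (*-cong jC≈ (+-cong (*-congˡ (*-cong gA≈ hB≈)) (-‿cong (*-congˡ (*-cong jC≈ jC≈)))))
          s-factor′))

      -- Inverts the definitions: U + V = 2 (f₃ - f₄), to be combined with 2 s.
      4f₃≈ : 4# * u₃ ≈ 2# * (j * ev C x y) + (g * ev A x y + h * ev B x y)
      4f₃≈ = trans
        (solve 5 (λ λ′ u₁ u₂ u₃ u₄ → con (+ 4) :* u₃ := con (+ 2) :* (u₃ :+ u₄)
            :+ (u₃ :- u₄ :- λ′ :* (u₁ :- u₂) :+ (u₃ :- u₄ :+ λ′ :* (u₁ :- u₂)))) refl λ′ u₁ u₂ u₃ u₄)
        (sym (+-cong (*-congˡ jC≈) (+-cong gA≈ hB≈)))

      4f₄≈ : 4# * u₄ ≈ 2# * (j * ev C x y) - (g * ev A x y + h * ev B x y)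
      4f₄≈ = trans
        (solve 5 (λ λ′ u₁ u₂ u₃ u₄ → con (+ 4) :* u₄ := con (+ 2) :* (u₃ :+ u₄)
            :- (u₃ :- u₄ :- λ′ :* (u₁ :- u₂) :+ (u₃ :- u₄ :+ λ′ :* (u₁ :- u₂)))) refl λ′ u₁ u₂ u₃ u₄)
        (sym (+-cong (*-congˡ jC≈) (-‿cong (+-cong gA≈ hB≈))))

      -- Here V - U = 2 λ (f₁ - f₂), while the hypothesis on the sums gives 2 λ (f₁ + f₂) = 2 λ³ s.
      4λf₁≈ : 4# * λ′ * u₁ ≈ 2# * pow λ′ 3 * (j * ev C x y) + (h * ev B x y - g * ev A x y)
      4λf₁≈ = trans
        (undifference (trans
          (solve 5 (λ λ′ u₁ u₂ u₃ u₄ →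
            con (+ 4) :* λ′ :* u₁ :- (con (+ 2) :* λ′ :^ 3 :* (u₃ :+ u₄)
              :+ (u₃ :- u₄ :+ λ′ :* (u₁ :- u₂) :- (u₃ :- u₄ :- λ′ :* (u₁ :- u₂))))
            := con (+ 2) :* λ′ :* (u₁ :+ u₂ :- λ′ :* λ′ :* (u₃ :+ u₄))) refl λ′ u₁ u₂ u₃ u₄)
          (_ ⊙ difference sum)))
        (sym (+-cong (*-congˡ jC≈) (+-cong hB≈ (-‿cong gA≈))))

      4λf₂≈ : 4# * λ′ * u₂ ≈ 2# * pow λ′ 3 * (j * ev C x y) - (h * ev B x y - g * ev A x y)
      4λf₂≈ = trans
        (undifference (trans
          (solve 5 (λ λ′ u₁ u₂ u₃ u₄ →
            con (+ 4) :* λ′ :* u₂ :- (con (+ 2) :* λ′ :^ 3 :* (u₃ :+ u₄)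
              :- (u₃ :- u₄ :+ λ′ :* (u₁ :- u₂) :- (u₃ :- u₄ :- λ′ :* (u₁ :- u₂))))
            := con (+ 2) :* λ′ :* (u₁ :+ u₂ :- λ′ :* λ′ :* (u₃ :+ u₄))) refl λ′ u₁ u₂ u₃ u₄)
          (_ ⊙ difference sum)))
        (sym (+-cong (*-congˡ jC≈) (-‿cong (+-cong hB≈ (-‿cong gA≈)))))

    open Values using (gA≈; hB≈; jC≈; CE≈0; 4f₃≈; 4f₄≈; 4λf₁≈; 4λf₂≈)

    4≉0 : ¬ (4# ≈ 0#)
    4≉0 = n·1≉0 3

    proportional : ∀ σ ρ → ¬ ((σ ≈ 0#) × (ρ ≈ 0#)) → (∀ x y → σ * ev f₃ x y ≈ - (ρ * ev f₄ x y)) → Proportional f₃ f₄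
    proportional σ ρ nonzero eq = σ , ρ , nonzero , toF-cong (ev-injective (σ *Q f₃) _ λ x y → trans
      (ev-scaleQ σ f₃ x y) (trans (eq x y)
        (solve 6 (λ ρ a b d x y → :- (ρ :* evᴾ a b d x y) := evᴾ (:- (ρ :* a)) (:- (ρ :* b)) (:- (ρ :* d)) x y)
          refl ρ (proj₁ f₄) (proj₁ (proj₂ f₄)) (proj₂ (proj₂ f₄)) x y)))

    -- If C = 0 then f₃ = - f₄; `Proportional` carries a minus sign, so both multipliers are 1.
    C≉0 : ¬ (C ≈Q (0# , 0# , 0#))
    C≉0 C≈0 = f₃∦f₄ (proportional 1# 1# (λ (1≈0 , _) → nontrivial 1≈0) λ x y → undifference (trans
      (solve 2 (λ u v → con (+ 1) :* u :- (:- (con (+ 1) :* v)) := u :+ v) refl (ev f₃ x y) (ev f₄ x y))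
      (trans (sym (jC≈ x y)) (j ⊙ trans (ev-cong C≈0 x y)
        (solve 2 (λ x y → evᴾ (con (+ 0)) (con (+ 0)) (con (+ 0)) x y := con (+ 0)) refl x y)))))

    -- Otherwise 4 f₃ = μ₃ A and 4 f₄ = μ₄ A, whence μ₄ f₃ = μ₃ f₄. Both multipliers vanish only if
    -- k = 0, that is, if C = 0.
    not-collinear : ¬ (∃ λ k → (C ≈Q scaleQ k A) × (B ≈Q scaleQ (k * k) A))
    not-collinear (k , C≈kA , B≈k²A) = f₃∦f₄ (proportional μ₄ (- μ₃) not-both-zero λ x y →
      undifference (*-cancel 4≉0 (trans
        (solve 4 (λ μ₃ μ₄ u₃ u₄ → con (+ 4) :* (μ₄ :* u₃ :- (:- ((:- μ₃) :* u₄)))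
          := μ₄ :* (con (+ 4) :* u₃) :- μ₃ :* (con (+ 4) :* u₄)) refl μ₃ μ₄ (ev f₃ x y) (ev f₄ x y))
        (trans (+-cong (*-congˡ (f₃-value x y)) (-‿cong (*-congˡ (f₄-value x y))))
        (solve 3 (λ μ₃ μ₄ a → μ₄ :* (μ₃ :* a) :- μ₃ :* (μ₄ :* a) := con (+ 0)) refl μ₃ μ₄ (ev A x y))))))
      where
      μ₃ μ₄ : K
      μ₃ = 2# * (j * k) + (g + h * (k * k))
      μ₄ = 2# * (j * k) - (g + h * (k * k))

      C-value : ∀ x y → ev C x y ≈ k * ev A x y
      C-value x y = trans (ev-cong C≈kA x y) (ev-scaleQ k A x y)

      B-value : ∀ x y → ev B x y ≈ k * k * ev A x y
      B-value x y = trans (ev-cong B≈k²A x y) (ev-scaleQ (k * k) A x y)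

      f₃-value : ∀ x y → 4# * ev f₃ x y ≈ μ₃ * ev A x y
      f₃-value x y = trans (4f₃≈ x y) (trans
        (+-cong (*-congˡ (*-congˡ (C-value x y))) (+-congˡ (*-congˡ (B-value x y))))
        (solve 5 (λ g h j k a → con (+ 2) :* (j :* (k :* a)) :+ (g :* a :+ h :* (k :* k :* a))
          := (con (+ 2) :* (j :* k) :+ (g :+ h :* (k :* k))) :* a) refl g h j k (ev A x y)))

      f₄-value : ∀ x y → 4# * ev f₄ x y ≈ μ₄ * ev A x y
      f₄-value x y = trans (4f₄≈ x y) (trans
        (+-cong (*-congˡ (*-congˡ (C-value x y))) (-‿cong (+-congˡ (*-congˡ (B-value x y)))))
        (solve 5 (λ g h j k a → con (+ 2) :* (j :* (k :* a)) :- (g :* a :+ h :* (k :* k :* a))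
          := (con (+ 2) :* (j :* k) :- (g :+ h :* (k :* k))) :* a) refl g h j k (ev A x y)))

      not-both-zero : ¬ ((μ₄ ≈ 0#) × (- μ₃ ≈ 0#))
      not-both-zero (μ₄≈0 , -μ₃≈0) = C≉0 (C₀≈0 , C₁≈0 , C₂≈0)
        where
        k≈0 : k ≈ 0#
        -- The identity used is μ₃ + μ₄ = 4 j k.
        k≈0 = *-cancel (*-≉0 4≉0 j≉0) (trans
          (solve 4 (λ g h j k → con (+ 4) :* j :* k :=
            con (+ 1) :* (con (+ 2) :* (j :* k) :- (g :+ h :* (k :* k)))
            :+ con -[1+ 0 ] :* (:- (con (+ 2) :* (j :* k) :+ (g :+ h :* (k :* k))))) refl g h j k)
          (1# ⊙ μ₄≈0 ⊕ (- 1#) ⊙ -μ₃≈0))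
        vanish : ∀ {u v} → u ≈ k * v → u ≈ 0#
        vanish u≈kv = trans u≈kv (trans (*-comm _ _) (_ ⊙ k≈0))
        C₀≈0 = vanish (proj₁ C≈kA)
        C₁≈0 = vanish (proj₁ (proj₂ C≈kA))
        C₂≈0 = vanish (proj₂ (proj₂ C≈kA))

    -- The linear change and the four composed forms.

    open Splitting (Split.splitting A B C CE≈0 not-collinear C≉0)

    κ : K
    κ = proj₁ (inverse (l₀ * m₁ - l₁ * m₀) δ≉0)

    κδ≈1 : (l₀ * m₁ - l₁ * m₀) * κ ≈ 1#
    κδ≈1 = proj₂ (inverse (l₀ * m₁ - l₁ * m₀) δ≉0)

    -- The change of variables with l ∘ M = x − y and m ∘ M = x + y.
    M : LinChange
    M = lin (κ * (m₁ - l₁)) (- (κ * (m₁ + l₁))) (κ * (l₀ - m₀)) (κ * (l₀ + m₀))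

    -- The determinant is 2 κ² (l₀ m₁ - l₁ m₀) = 2 κ.
    det≉0 : ¬ (det M ≈ 0#)
    det≉0 det≈0 = *-≉0 {2#} (n·1≉0 1) κ≉0 (trans
      (solve 5 (λ κ l₀ l₁ m₀ m₁ → con (+ 2) :* κ :=
          con (+ 1) :* (κ :* (m₁ :- l₁) :* (κ :* (l₀ :+ m₀)) :- (:- (κ :* (m₁ :+ l₁))) :* (κ :* (l₀ :- m₀)))
          :+ (:- (con (+ 2) :* κ)) :* ((l₀ :* m₁ :- l₁ :* m₀) :* κ :- con (+ 1))) refl κ l₀ l₁ m₀ m₁)
      (1# ⊙ det≈0 ⊕ (- (2# * κ)) ⊙ difference κδ≈1))
      where
      κ≉0 : ¬ (κ ≈ 0#)
      κ≉0 κ≈0 = nontrivial (trans (sym κδ≈1) (_ ⊙ κ≈0))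

    module Composed (x y : K) where
      X Y : K
      X = κ * (m₁ - l₁) * x + - (κ * (m₁ + l₁)) * y
      Y = κ * (l₀ - m₀) * x + κ * (l₀ + m₀) * y

      l≈ : linear l₀ l₁ X Y ≈ x - y
      l≈ = undifference (trans
        (solve 7 (λ κ l₀ l₁ m₀ m₁ x y →
            linearᴾ l₀ l₁ (κ :* (m₁ :- l₁) :* x :+ (:- (κ :* (m₁ :+ l₁))) :* y) (κ :* (l₀ :- m₀) :* x :+ κ :* (l₀ :+ m₀) :* y)
            :- (x :- y) := (x :- y) :* ((l₀ :* m₁ :- l₁ :* m₀) :* κ :- con (+ 1))) refl κ l₀ l₁ m₀ m₁ x y)
        ((x - y) ⊙ difference κδ≈1))

      m≈ : linear m₀ m₁ X Y ≈ x + y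
      m≈ = undifference (trans
        (solve 7 (λ κ l₀ l₁ m₀ m₁ x y →
            linearᴾ m₀ m₁ (κ :* (m₁ :- l₁) :* x :+ (:- (κ :* (m₁ :+ l₁))) :* y) (κ :* (l₀ :- m₀) :* x :+ κ :* (l₀ :+ m₀) :* y)
            :- (x :+ y) := (x :+ y) :* ((l₀ :* m₁ :- l₁ :* m₀) :* κ :- con (+ 1))) refl κ l₀ l₁ m₀ m₁ x y)
        ((x + y) ⊙ difference κδ≈1))

      A∘M : ev A X Y ≈ (x - y) * (x - y)
      A∘M = trans (ev-cong A≈ll X Y) (trans (ev-product l₀ l₁ l₀ l₁ X Y) (*-cong l≈ l≈))

      B∘M : ev B X Y ≈ (x + y) * (x + y)
      B∘M = trans (ev-cong B≈mm X Y) (trans (ev-product m₀ m₁ m₀ m₁ X Y) (*-cong m≈ m≈))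

      C∘M : ev C X Y ≈ (x - y) * (x + y)
      C∘M = trans (ev-cong C≈lm X Y) (trans (ev-product l₀ l₁ m₀ m₁ X Y) (*-cong l≈ m≈))

    -- The forms are known through A, B, C only after multiplication by k = 4 or 4 λ, which is
    -- cancelled here.
    identify : ∀ k f F → ¬ (k ≈ 0#) →
      (∀ x y → let open Composed x y in k * ev f X Y - k * ev F x y ≈ 0#) → compT f M ≈F toF F
    identify k f F k≉0 eq = toF-cong (ev-injective (compose f M) F λ x y → trans
      (ev-compose f _ _ _ _ x y)
      (undifference (*-cancel k≉0 (trans
        (solve 3 (λ k u v → k :* (u :- v) := k :* u :- k :* v) refl k _ _) (eq x y)))))

    open Special ω λ′

    -- Once A, B, C are replaced by (x - y)², (x + y)², (x - y) (x + y), the two sides differ by a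
    -- multiple of ω² + ω + 1. The other three forms are treated alike.
    f₁∘M : compT f₁ M ≈F F3
    f₁∘M = identify (4# * λ′) f₁ (pow λ′ 3 * pow ω 2 , - 1# , pow λ′ 3 * ω) (*-≉0 4≉0 λ≉0) λ x y →
      let open Composed x y in trans
      (+-congʳ (trans (4λf₁≈ X Y)
        (+-cong (*-congˡ (*-congˡ C∘M)) (+-cong (*-congˡ B∘M) (-‿cong (*-congˡ A∘M))))))
      (trans (solve 4 (λ L ω x y →
          con (+ 2) :* L :^ 3 :* (L :* (ω :^ 2 :- ω) :* ((x :- y) :* (x :+ y)))
          :+ ((:- (L :^ 4 :+ L)) :* ((x :+ y) :* (x :+ y)) :- (L :^ 4 :- L) :* ((x :- y) :* (x :- y)))
          :- con (+ 4) :* L :* evᴾ (L :^ 3 :* ω :^ 2) (con -[1+ 0 ]) (L :^ 3 :* ω) x y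
          := (:- (con (+ 2) :* L :^ 4 :* (x :* x :+ y :* y))) :* (ω :* ω :+ ω :+ con (+ 1))) refl λ′ ω x y)
        (_ ⊙ ω²+ω+1≈0))

    f₂∘M : compT f₂ M ≈F negF F5
    f₂∘M = identify (4# * λ′) f₂ (- (pow λ′ 3 * ω) , - (- 1#) , - (pow λ′ 3 * pow ω 2)) (*-≉0 4≉0 λ≉0) λ x y →
      let open Composed x y in trans
      (+-congʳ (trans (4λf₂≈ X Y)
        (+-cong (*-congˡ (*-congˡ C∘M)) (-‿cong (+-cong (*-congˡ B∘M) (-‿cong (*-congˡ A∘M)))))))
      (trans (solve 4 (λ L ω x y →
          con (+ 2) :* L :^ 3 :* (L :* (ω :^ 2 :- ω) :* ((x :- y) :* (x :+ y)))
          :- ((:- (L :^ 4 :+ L)) :* ((x :+ y) :* (x :+ y)) :- (L :^ 4 :- L) :* ((x :- y) :* (x :- y)))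
          :- con (+ 4) :* L :* evᴾ (:- (L :^ 3 :* ω)) (:- con -[1+ 0 ]) (:- (L :^ 3 :* ω :^ 2)) x y
          := con (+ 2) :* L :^ 4 :* (x :* x :+ y :* y) :* (ω :* ω :+ ω :+ con (+ 1))) refl λ′ ω x y)
        (_ ⊙ ω²+ω+1≈0))

    f₃∘M : compT f₃ M ≈F negF F4
    f₃∘M = identify 4# f₃ (- (- (λ′ * pow ω 2)) , - pow λ′ 4 , - (- (λ′ * ω))) 4≉0 λ x y →
      let open Composed x y in trans
      (+-congʳ (trans (4f₃≈ X Y)
        (+-cong (*-congˡ (*-congˡ C∘M)) (+-cong (*-congˡ A∘M) (*-congˡ B∘M)))))
      (trans (solve 4 (λ L ω x y →
          con (+ 2) :* (L :* (ω :^ 2 :- ω) :* ((x :- y) :* (x :+ y)))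
          :+ ((L :^ 4 :- L) :* ((x :- y) :* (x :- y)) :+ (:- (L :^ 4 :+ L)) :* ((x :+ y) :* (x :+ y)))
          :- con (+ 4) :* evᴾ (:- (:- (L :* ω :^ 2))) (:- L :^ 4) (:- (:- (L :* ω))) x y
          := (:- (con (+ 2) :* L :* (x :* x :+ y :* y))) :* (ω :* ω :+ ω :+ con (+ 1))) refl λ′ ω x y)
        (_ ⊙ ω²+ω+1≈0))

    f₄∘M : compT f₄ M ≈F F6
    f₄∘M = identify 4# f₄ (- (λ′ * ω) , pow λ′ 4 , - (λ′ * pow ω 2)) 4≉0 λ x y →
      let open Composed x y in trans
      (+-congʳ (trans (4f₄≈ X Y)
        (+-cong (*-congˡ (*-congˡ C∘M)) (-‿cong (+-cong (*-congˡ A∘M) (*-congˡ B∘M))))))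
      (trans (solve 4 (λ L ω x y →
          con (+ 2) :* (L :* (ω :^ 2 :- ω) :* ((x :- y) :* (x :+ y)))
          :- ((L :^ 4 :- L) :* ((x :- y) :* (x :- y)) :+ (:- (L :^ 4 :+ L)) :* ((x :+ y) :* (x :+ y)))
          :- con (+ 4) :* evᴾ (:- (L :* ω)) (L :^ 4) (:- (L :* ω :^ 2)) x y
          := con (+ 2) :* L :* (x :* x :+ y :* y) :* (ω :* ω :+ ω :+ con (+ 1))) refl λ′ ω x y)
        (_ ⊙ ω²+ω+1≈0))

theorem4p3 : ∀ {c ℓ : Level} (R : CommutativeRing c ℓ) →
    let open CommutativeRing R
        open Forms R
    in IsAlgClosedFieldChar0 →
       (ω : K) → pow ω 3 ≈ 1# → ¬ (ω ≈ 1#) →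
       (f₁ f₂ f₃ f₄ : K × K × K) →
       ¬ Proportional f₁ f₂ → ¬ Proportional f₁ f₃ → ¬ Proportional f₁ f₄ →
       ¬ Proportional f₂ f₃ → ¬ Proportional f₂ f₄ → ¬ Proportional f₃ f₄ →
       addF (cubeF (toF f₁)) (cubeF (toF f₂)) ≈F addF (cubeF (toF f₃)) (cubeF (toF f₄)) →
       (T : K) →
       addF (toF f₁) (toF f₂) ≈F scaleF T (addF (toF f₃) (toF f₄)) →
       ¬ (T * (pow T 3 - 1#) ≈ 0#) →
       (λ' : K) → λ' * λ' ≈ T →
       let open Special ω λ' in
       ∃ λ (M : LinChange) → ¬ (det M ≈ 0#) ×
         PairEq (compT f₁ M) (compT f₂ M) F3 (negF F5) ×
         PairEq (compT f₃ M) (compT f₄ M) (negF F4) F6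
theorem4p3 R isAlgClosed ω ω³≈1 ω≉1 f₁ f₂ f₃ f₄ _ _ _ _ _ f₃∦f₄ cubes T sums T-generic λ′ λ²≈T =
  -- Both pairs match in the listed order, because U and V, and with them `M`, are built from the
  -- given labelling.
  M , det≉0 , inj₁ (f₁∘M , f₂∘M) , inj₁ (f₃∘M , f₄∘M)
  where
  open Parametrisation.Solution R isAlgClosed ω ω³≈1 ω≉1 f₁ f₂ f₃ f₄ f₃∦f₄ cubes T sums T-generic λ′ λ²≈T
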